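{- Let $\Gamma$ be a bridgeless metrized graph of genus $g$. Then $$g\cdot x(\Gamma)=y(\Gamma)+\sum_{e_i\in E(\Gamma)}\frac{L_i}{L_i+R_i}x(\Gamma-e_i),\qquad (g+1)\,y(\Gamma)=\sum_{e_i\in E(\Gamma)}\frac{L_i}{L_i+R_i}y(\Gamma-e_i).$$
   Context: A metrized graph is a finite connected graph (multiple edges and self-loops allowed) whose edges $e_j$ are identified with closed segments of lengths $L_j>0$; its vertex set is finite, nonempty, and contains all points of valence $\neq2$; $g=e-v+1$. $G-e_j$ is $G$ with the interior of $e_j$ removed; $\Gamma$ is bridgeless if each $\Gamma-e_j$ is connected. View a metrized graph $G$ as an electric circuit with edge resistances equal to lengths; the voltage function $j_z(x,y)$ is the voltage at $x$ (reference $0$ at $z$) when unit current enters at $y$ and exits at $z$. For an edge $e_j$ of $G$ with endpoints $p_j,q_j$, $R_j$ is the effective resistance between $p_j,q_j$ in $G-e_j$, and for a fixed vertex $p$, with $\hat j$ the voltage function of $G-e_j$, $R_{a_j,p}=\hat j_{p_j}(p,q_j)$, $R_{b_j,p}=\hat j_{q_j}(p_j,p)$. Define $y(G)=\frac14\sum_{e_j}\frac{L_jR_j^2}{(L_j+R_j)^2}+\frac34\sum_{e_j}\frac{L_j(R_{a_j,p}-R_{b_j,p})^2}{(L_j+R_j)^2}$, $x(G)=\sum_{e_j}\frac{L_j^2R_j}{(L_j+R_j)^2}+\frac34\sum_{e_j}\frac{L_jR_j^2}{(L_j+R_j)^2}-\frac34\sum_{e_j}\frac{L_j(R_{a_j,p}-R_{b_j,p})^2}{(L_j+R_j)^2}$.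 If $e_j$ is a bridge of $G$ ($R_j=\infty$), then $(R_{a_j,p}-R_{b_j,p})^2=R_j^2$ and each summand is replaced by its limit as $R_j\to\infty$. $R_i$ in the claim refers to $\Gamma$. -}

module Defs where

open import Level using (Level; _⊔_) renaming (suc to lsuc)
open import Algebra.Bundles using (CommutativeRing)
open import Relation.Binary.Core using (Rel)
open import Relation.Binary.Structures using (IsStrictTotalOrder)
open import Data.Nat using (ℕ; zero; suc; _∸_)
open import Data.Fin using (Fin; _≟_)
open import Data.List using (List; length; lookup; removeAt)
open import Data.Product using (Σ; _×_; proj₁)
open import Data.Sum using (_⊎_; [_,_]′)
open import Data.Bool using (if_then_else_)
open import Relation.Nullary using (¬_; does)
open import Relation.Binary.PropositionalEquality using (_≡_)

-- An ordered field (the real numbers are a model).  The inverse is total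
-- with the convention 0⁻¹ = 0; it is only ever applied to positive elements.
record OrderedField (c ℓ₁ ℓ₂ : Level) : Set (lsuc (c ⊔ ℓ₁ ⊔ ℓ₂)) where
  field
    commutativeRing : CommutativeRing c ℓ₁
  open CommutativeRing commutativeRing
  infix 4 _<_
  infix 8 _⁻¹
  field
    _<_                : Rel Carrier ℓ₂
    isStrictTotalOrder : IsStrictTotalOrder _≈_ _<_
    +-monoˡ-<          : ∀ {a b} z → a < b → a + z < b + z
    *-pos              : ∀ {a b} → 0# < a → 0# < b → 0# < a * b
    0<1                : 0# < 1#
    _⁻¹                : Carrier → Carrier
    ⁻¹-cong            : ∀ {a b} → a ≈ b → a ⁻¹ ≈ b ⁻¹
    ⁻¹-inverse         : ∀ a → ¬ (a ≈ 0#) → a * a ⁻¹ ≈ 1#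
    0⁻¹                : 0# ⁻¹ ≈ 0#

module Network {c ℓ₁ ℓ₂ : Level} (F : OrderedField c ℓ₁ ℓ₂) where
  open OrderedField F
  open CommutativeRing commutativeRing

  _÷_ : Carrier → Carrier → Carrier
  a ÷ b = a * b ⁻¹

  fromℕ : ℕ → Carrier
  fromℕ zero    = 0#
  fromℕ (suc n) = 1# + fromℕ n

  ∑ : (n : ℕ) → (Fin n → Carrier) → Carrier
  ∑ zero    f = 0#
  ∑ (suc n) f = f Fin.zero + ∑ n (λ i → f (Fin.suc i))

  record Edge (n : ℕ) : Set c where
    field
      src tgt : Fin n
      len     : Carrier

  record MGraph : Set c where
    field
      nv    : ℕ
      edges : List (Edge nv)
  open MGraph public

  nE : MGraph → ℕ
  nE G = length (edges G)

  edge : (G : MGraph) → Fin (nE G) → Edge (nv G)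
  edge G k = lookup (edges G) k

  _─_ : (G : MGraph) → Fin (nE G) → MGraph
  G ─ k = record { nv = nv G ; edges = removeAt (edges G) k }

  PositiveLengths : MGraph → Set ℓ₂
  PositiveLengths G = ∀ k → 0# < Edge.len (edge G k)

  data Reach (G : MGraph) : Fin (nv G) → Fin (nv G) → Set where
    here : ∀ {a} → Reach G a a
    fwd  : ∀ {a b} k → Edge.src (edge G k) ≡ a → Reach G (Edge.tgt (edge G k)) b → Reach G a b
    bwd  : ∀ {a b} k → Edge.tgt (edge G k) ≡ a → Reach G (Edge.src (edge G k)) b → Reach G a b

  Connected : MGraph → Set
  Connected G = ∀ a b → Reach G a b

  Bridgeless : MGraph → Set
  Bridgeless G = ∀ k → Connected (G ─ k)

  -- genus g = e - v + 1 (exact for connected graphs)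
  genus : MGraph → ℕ
  genus G = suc (nE G) ∸ nv G

  δ : ∀ {n} → Fin n → Fin n → Carrier
  δ a b = if does (a ≟ b) then 1# else 0#

  -- net current flowing out of vertex w under potential φ (Ohm's law, resistance = length)
  outflow : (G : MGraph) → (Fin (nv G) → Carrier) → Fin (nv G) → Carrier
  outflow G φ w = ∑ (nE G) λ k →
    (δ (Edge.src (edge G k)) w * (φ (Edge.src (edge G k)) - φ (Edge.tgt (edge G k)))
     + δ (Edge.tgt (edge G k)) w * (φ (Edge.tgt (edge G k)) - φ (Edge.src (edge G k))))
    ÷ Edge.len (edge G k)

  -- φ is the potential when unit current enters at y and exits at z, with φ z = 0
  IsVoltage : (G : MGraph) → Fin (nv G) → Fin (nv G) → (Fin (nv G) → Carrier) → Set ℓ₁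
  IsVoltage G z y φ = (φ z ≈ 0#) × (∀ w → outflow G φ w ≈ δ w y - δ w z)

  VoltageFn : MGraph → Set (c ⊔ ℓ₁)
  VoltageFn G = Σ (Fin (nv G) → Fin (nv G) → Fin (nv G) → Carrier)
                  λ j → ∀ z y → IsVoltage G z y (λ x → j z x y)

  ElecData : MGraph → Set (c ⊔ ℓ₁)
  ElecData G = (k : Fin (nE G)) → (¬ Connected (G ─ k)) ⊎ VoltageFn (G ─ k)

  ¼ ¾ : Carrier
  ¼ = fromℕ 4 ⁻¹
  ¾ = fromℕ 3 ÷ fromℕ 4

  sq : Carrier → Carrier
  sq a = a * a

  Rk : (G : MGraph) (k : Fin (nE G)) → VoltageFn (G ─ k) → Carrier
  Rk G k V = proj₁ V (Edge.tgt (edge G k)) (Edge.src (edge G k)) (Edge.src (edge G k))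

  Rak : (G : MGraph) (p : Fin (nv G)) (k : Fin (nE G)) → VoltageFn (G ─ k) → Carrier
  Rak G p k V = proj₁ V (Edge.src (edge G k)) p (Edge.tgt (edge G k))

  Rbk : (G : MGraph) (p : Fin (nv G)) (k : Fin (nE G)) → VoltageFn (G ─ k) → Carrier
  Rbk G p k V = proj₁ V (Edge.tgt (edge G k)) (Edge.src (edge G k)) p

  -- summands of x(G), y(G); bridge case = limit R → ∞ with (R_a - R_b)^2 = R^2
  xTerm : (G : MGraph) (p : Fin (nv G)) (k : Fin (nE G)) → (¬ Connected (G ─ k)) ⊎ VoltageFn (G ─ k) → Carrier
  xTerm G p k = [ (λ _ → 0# + ¾ * L - ¾ * L)
                , (λ V → let R = Rk G k V ; D = Rak G p k V - Rbk G p k V in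
                     (sq L * R) ÷ sq (L + R) + ¾ * ((L * sq R) ÷ sq (L + R))
                     - ¾ * ((L * sq D) ÷ sq (L + R))) ]′
    where L = Edge.len (edge G k)

  yTerm : (G : MGraph) (p : Fin (nv G)) (k : Fin (nE G)) → (¬ Connected (G ─ k)) ⊎ VoltageFn (G ─ k) → Carrier
  yTerm G p k = [ (λ _ → ¼ * L + ¾ * L)
                , (λ V → let R = Rk G k V ; D = Rak G p k V - Rbk G p k V in
                     ¼ * ((L * sq R) ÷ sq (L + R)) + ¾ * ((L * sq D) ÷ sq (L + R))) ]′
    where L = Edge.len (edge G k)

  xval : (G : MGraph) → Fin (nv G) → ElecData G → Carrier
  xval G p D = ∑ (nE G) λ k → xTerm G p k (D k)

  yval : (G : MGraph) → Fin (nv G) → ElecData G → Carrier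
  yval G p D = ∑ (nE G) λ k → yTerm G p k (D k)

{-# OPTIONS --safe #-}

-- Let g be the Green function of Γ that vanishes at p and, for an edge e from s to t, let
-- ψ_e = g(·,s) − g(·,t), a = ψ_e(s), b = ψ_e(t), r_e = a − b.  In every connected graph the
-- summands of y and of x + y are (a² + ab + b²)/L_e and r_e, bridges included.  Deleting e_i
-- is a rank-one update: with F_i = L_i/(L_i + R_i) = 1 − r_i/L_i it adds
-- ψ_i(x) ψ_i(y)/(L_i F_i) to g, so F_i y(Γ − e_i) and F_i (x + y)(Γ − e_i) expand into sums
-- over the edges of Γ.  The terms that carry 1/F_i combine by the Green identity applied to
-- ψ_i³ and ψ_i, because (u − v)(u² + uv + v²) = u³ − v³.  Summation over i then only needs
-- Σ_i (ψ_i(s_j) − ψ_i(t_j)) ψ_i(x)/L_i = ψ_j(x) and Foster's identity: Σ_i F_i is the genus.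
module Submission where

open import Defs
open import Level using (Level)
open import Algebra.Bundles using (CommutativeRing)
open import Data.Nat using (ℕ; zero; suc)
open import Data.Fin as Fin using (Fin)
open import Data.Product using (_×_; ∃; _,_; proj₁; proj₂)
open import Data.List using (List; _∷_; []; length; lookup; removeAt)
open import Data.Sum using (inj₂)

-- The obstacle is the double deletion: x and y of Γ - e_i refer to the graphs Γ - e_i - e_j, which
-- may be disconnected. Expressing the summands through a Green function of Γ - e_i removes the
-- second deletion, and expressing that function through g removes the first. The weights ¼ and ¾
-- fit this because 4(a² + ab + b²) = (a - b)² + 3(a + b)², where a - b = F R and a + b = F (R_a -
-- R_b) with F = L/(L + R). Two ingredients have to be built. Voltage functions are supplied only
-- for graphs with an edge deleted, so g itself comes from the same rank-one update run in the other
-- direction, restoring an edge. And a bridge is given only by the negation of connectedness, which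
-- exhibits no component; since equality in an ordered field is decidable, reachability can be
-- treated classically under a double negation and the resulting equations still hold.

module ℤ-CoefficientSolver {c ℓ : Level} (R : CommutativeRing c ℓ) where
  open CommutativeRing R
  open import Algebra.Properties.Ring ring using (-‿distribˡ-*; -‿distribʳ-*)
  open import Algebra.Properties.AbelianGroup +-abelianGroup
    using (ε⁻¹≈ε; ⁻¹-∙-comm; ⁻¹-involutive)
  open import Algebra.Properties.Semiring.Mult.TCOptimised semiring
    using (1+×; ×-homo-+; ×1-homo-*) renaming (_×_ to _·_)
  open import Algebra.Solver.Ring.AlmostCommutativeRing
    using (fromCommutativeRing; _-Raw-AlmostCommutative⟶_)
  open import Relation.Binary.Reasoning.Setoid setoid
  open import Relation.Binary.PropositionalEquality as ≡ using (_≡_)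
  open import Data.Integer as ℤ using (ℤ; -[1+_]; +_; _⊖_; _◃_)
  open import Data.Integer.Properties as ℤ using ([1+m]⊖[1+n]≡m⊖n; +◃n≡+n; -◃n≡-n)
  import Data.Nat as ℕ
  import Data.Nat.Properties as ℕ
  open import Data.Sign as Sign using (Sign)
  open import Data.Maybe using (Maybe; just; nothing)
  open import Relation.Nullary using (yes; no)

  -- With the optimised multiples `1 · 1#` reduces to `1#`, so the solver constants `con (+ 0)` and
  -- `con (+ 1)` agree with `0#` and `1#` by computation.
  ⟦_⟧ℤ : ℤ → Carrier
  ⟦ + n ⟧ℤ      = n · 1#
  ⟦ -[1+ n ] ⟧ℤ = - (suc n · 1#)

  ⟦⟧ℤ-cong : ∀ {i j} → i ≡ j → ⟦ i ⟧ℤ ≈ ⟦ j ⟧ℤ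
  ⟦⟧ℤ-cong ≡.refl = refl

  neg-homo : ∀ i → ⟦ ℤ.- i ⟧ℤ ≈ - ⟦ i ⟧ℤ
  neg-homo (+ zero)  = sym ε⁻¹≈ε
  neg-homo (+ suc n) = refl
  neg-homo -[1+ n ]  = sym (⁻¹-involutive _)

  ⊖-homo : ∀ m n → ⟦ m ⊖ n ⟧ℤ ≈ m · 1# - n · 1#
  ⊖-homo m zero = sym (trans (+-congˡ ε⁻¹≈ε) (+-identityʳ _))
  ⊖-homo zero (suc n) = sym (+-identityˡ _)
  ⊖-homo (suc m) (suc n) = begin
    ⟦ suc m ⊖ suc n ⟧ℤ                    ≈⟨ ⟦⟧ℤ-cong ([1+m]⊖[1+n]≡m⊖n m n) ⟩
    ⟦ m ⊖ n ⟧ℤ                            ≈⟨ ⊖-homo m n ⟩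
    m · 1# - n · 1#                       ≈⟨ +-congʳ (+-identityˡ _) ⟨
    -- The inserted zero is split as `1# - 1#`, and each of the two multiples receives one of the
    -- summands.
    0# + m · 1# - n · 1#                  ≈⟨ +-congʳ (+-congʳ (-‿inverseʳ 1#)) ⟨
    1# - 1# + m · 1# - n · 1#             ≈⟨ +-congʳ (+-assoc 1# (- 1#) (m · 1#)) ⟩
    1# + (- 1# + m · 1#) - n · 1#         ≈⟨ +-congʳ (+-congˡ (+-comm (- 1#) (m · 1#))) ⟩
    1# + (m · 1# + - 1#) - n · 1#         ≈⟨ +-congʳ (+-assoc 1# (m · 1#) (- 1#)) ⟨
    1# + m · 1# + - 1# - n · 1#           ≈⟨ +-assoc (1# + m · 1#) (- 1#) (- (n · 1#)) ⟩
    1# + m · 1# + (- 1# - n · 1#)         ≈⟨ +-congˡ (⁻¹-∙-comm 1# (n · 1#)) ⟩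
    1# + m · 1# - (1# + n · 1#)           ≈⟨ +-cong (1+× m 1#) (-‿cong (1+× n 1#)) ⟨
    suc m · 1# - suc n · 1#               ∎

  +-homo : ∀ i j → ⟦ i ℤ.+ j ⟧ℤ ≈ ⟦ i ⟧ℤ + ⟦ j ⟧ℤ
  +-homo (+ m)    (+ n)    = ×-homo-+ 1# m n
  +-homo (+ m)    -[1+ n ] = ⊖-homo m (suc n)
  +-homo -[1+ m ] (+ n)    = trans (⊖-homo n (suc m)) (+-comm _ _)
  +-homo -[1+ m ] -[1+ n ] = begin
    - (suc (suc (m ℕ.+ n)) · 1#)    ≡⟨ ≡.cong (λ k → - (suc k · 1#)) (ℕ.+-suc m n) ⟨
    - ((suc m ℕ.+ suc n) · 1#)      ≈⟨ -‿cong (×-homo-+ 1# (suc m) (suc n)) ⟩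
    - (suc m · 1# + suc n · 1#)     ≈⟨ ⁻¹-∙-comm _ _ ⟨
    - (suc m · 1#) - (suc n · 1#)   ∎

  -◃-homo : ∀ n → ⟦ Sign.- ◃ n ⟧ℤ ≈ - (n · 1#)
  -◃-homo n = trans (⟦⟧ℤ-cong (-◃n≡-n n)) (neg-homo (+ n))

  *-homo : ∀ i j → ⟦ i ℤ.* j ⟧ℤ ≈ ⟦ i ⟧ℤ * ⟦ j ⟧ℤ
  *-homo (+ m) (+ n) = trans (⟦⟧ℤ-cong (+◃n≡+n (m ℕ.* n))) (×1-homo-* m n)
  *-homo (+ m) -[1+ n ] = begin
    ⟦ Sign.- ◃ (m ℕ.* suc n) ⟧ℤ   ≈⟨ -◃-homo (m ℕ.* suc n) ⟩
    - ((m ℕ.* suc n) · 1#)        ≈⟨ -‿cong (×1-homo-* m (suc n)) ⟩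
    - (m · 1# * suc n · 1#)       ≈⟨ -‿distribʳ-* _ _ ⟩
    m · 1# * - (suc n · 1#)       ∎
  *-homo -[1+ m ] (+ n) = begin
    ⟦ Sign.- ◃ (suc m ℕ.* n) ⟧ℤ   ≈⟨ -◃-homo (suc m ℕ.* n) ⟩
    - ((suc m ℕ.* n) · 1#)        ≈⟨ -‿cong (×1-homo-* (suc m) n) ⟩
    - (suc m · 1# * n · 1#)       ≈⟨ -‿distribˡ-* _ _ ⟩
    - (suc m · 1#) * n · 1#       ∎
  *-homo -[1+ m ] -[1+ n ] = begin
    ⟦ Sign.+ ◃ (suc m ℕ.* suc n) ⟧ℤ       ≈⟨ ⟦⟧ℤ-cong (+◃n≡+n (suc m ℕ.* suc n)) ⟩
    (suc m ℕ.* suc n) · 1#                ≈⟨ ×1-homo-* (suc m) (suc n) ⟩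
    suc m · 1# * suc n · 1#               ≈⟨ ⁻¹-involutive _ ⟨
    - - (suc m · 1# * suc n · 1#)         ≈⟨ -‿cong (-‿distribˡ-* _ _) ⟩
    - (- (suc m · 1#) * suc n · 1#)       ≈⟨ -‿distribʳ-* _ _ ⟩
    - (suc m · 1#) * - (suc n · 1#)       ∎

  morphism : ℤ.+-*-rawRing -Raw-AlmostCommutative⟶ fromCommutativeRing R
  morphism = record
    { ⟦_⟧    = ⟦_⟧ℤ
    ; +-homo = +-homo
    ; *-homo = *-homo
    ; -‿homo = neg-homo
    ; 0-homo = refl
    ; 1-homo = refl
    }

  _coeff≟_ : ∀ i j → Maybe (⟦ i ⟧ℤ ≈ ⟦ j ⟧ℤ)
  i coeff≟ j with i ℤ.≟ j
  ... | yes i≡j = just (⟦⟧ℤ-cong i≡j)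
  ... | no  _   = nothing

  open import Algebra.Solver.Ring ℤ.+-*-rawRing (fromCommutativeRing R) morphism _coeff≟_ public
    using (solve; _:=_; _:+_; _:*_; _:-_; :-_; con)


module Electrical {c ℓ₁ ℓ₂ : Level} (F : OrderedField c ℓ₁ ℓ₂) where
  open OrderedField F
  open CommutativeRing commutativeRing
  open Network F
  open Edge
  open ℤ-CoefficientSolver commutativeRing using (solve; _:=_; _:+_; _:*_; _:-_; :-_; con)
  open import Relation.Binary.Reasoning.Setoid setoid
  open import Relation.Binary.Structures using (IsStrictTotalOrder)
  open import Relation.Binary.Definitions using (tri<; tri≈; tri>)
  open import Relation.Binary.PropositionalEquality as ≡ using (_≡_)
  open import Relation.Nullary using (¬_; Dec; yes; no; does; contradiction)
  open import Data.Integer using (+_)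
  open import Data.Sum using (_⊎_; inj₁)
  open import Data.Bool using (if_then_else_)
  open import Data.Fin.Properties using (sequence)
  open import Effect.Monad using (RawMonad)
  open import Relation.Nullary.Decidable using (decidable-stable; ¬¬-excluded-middle)
  open import Relation.Nullary.Negation using (¬¬-Monad; ¬¬-map)
  import Data.Nat as ℕ
  import Data.Nat.Properties as ℕ
  private module < = IsStrictTotalOrder isStrictTotalOrder

  -- Finite sums

  ∑-cong : ∀ n {f h : Fin n → Carrier} → (∀ i → f i ≈ h i) → ∑ n f ≈ ∑ n h
  ∑-cong zero    f≈h = refl
  ∑-cong (suc n) f≈h = +-cong (f≈h Fin.zero) (∑-cong n (λ i → f≈h (Fin.suc i)))

  ∑-zero : ∀ n → ∑ n (λ _ → 0#) ≈ 0#
  ∑-zero zero    = refl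
  ∑-zero (suc n) = trans (+-identityˡ _) (∑-zero n)

  ∑-one : ∀ n → ∑ n (λ _ → 1#) ≈ fromℕ n
  ∑-one zero    = refl
  ∑-one (suc n) = +-congˡ (∑-one n)

  ∑-+ : ∀ n (f h : Fin n → Carrier) → ∑ n (λ i → f i + h i) ≈ ∑ n f + ∑ n h
  ∑-+ zero    f h = sym (+-identityˡ 0#)
  ∑-+ (suc n) f h = trans
    (+-congˡ (∑-+ n (λ i → f (Fin.suc i)) (λ i → h (Fin.suc i))))
    (solve 4 (λ a b c d → (a :+ b) :+ (c :+ d) := (a :+ c) :+ (b :+ d)) refl _ _ _ _)

  ∑-*ˡ : ∀ n x (f : Fin n → Carrier) → ∑ n (λ i → x * f i) ≈ x * ∑ n f
  ∑-*ˡ zero    x f = sym (zeroʳ x)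
  ∑-*ˡ (suc n) x f = trans (+-congˡ (∑-*ˡ n x (λ i → f (Fin.suc i)))) (sym (distribˡ x _ _))

  ∑-*ʳ : ∀ n x (f : Fin n → Carrier) → ∑ n (λ i → f i * x) ≈ ∑ n f * x
  ∑-*ʳ n x f = trans (∑-cong n (λ i → *-comm (f i) x)) (trans (∑-*ˡ n x f) (*-comm x _))

  ∑-- : ∀ n (f h : Fin n → Carrier) → ∑ n (λ i → f i - h i) ≈ ∑ n f - ∑ n h
  ∑-- zero    f h = sym (-‿inverseʳ 0#)
  ∑-- (suc n) f h = trans
    (+-congˡ (∑-- n (λ i → f (Fin.suc i)) (λ i → h (Fin.suc i))))
    (solve 4 (λ a b c d → (a :- b) :+ (c :- d) := (a :+ c) :- (b :+ d)) refl _ _ _ _)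

  ∑-swap : ∀ m n (f : Fin m → Fin n → Carrier) →
           ∑ m (λ i → ∑ n (f i)) ≈ ∑ n (λ j → ∑ m (λ i → f i j))
  ∑-swap zero    n f = sym (∑-zero n)
  ∑-swap (suc m) n f = trans
    (+-congˡ (∑-swap m n (λ i → f (Fin.suc i))))
    (sym (∑-+ n (f Fin.zero) (λ j → ∑ m (λ i → f (Fin.suc i) j))))

  ∑-δ : ∀ {n} (a : Fin n) (f : Fin n → Carrier) → ∑ n (λ w → δ a w * f w) ≈ f a
  ∑-δ {suc n} Fin.zero f = begin
    1# * f Fin.zero + ∑ n (λ w → 0# * f (Fin.suc w))
      ≈⟨ +-cong (*-identityˡ _) (∑-*ˡ n 0# (λ w → f (Fin.suc w))) ⟩
    f Fin.zero + 0# * ∑ n (λ w → f (Fin.suc w))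
      ≈⟨ +-congˡ (zeroˡ _) ⟩
    f Fin.zero + 0#
      ≈⟨ +-identityʳ _ ⟩
    f Fin.zero ∎
  ∑-δ {suc n} (Fin.suc a) f = begin
    0# * f Fin.zero + ∑ n (λ w → δ a w * f (Fin.suc w))
      ≈⟨ +-cong (zeroˡ _) (∑-δ a (λ w → f (Fin.suc w))) ⟩
    0# + f (Fin.suc a)
      ≈⟨ +-identityˡ _ ⟩
    f (Fin.suc a) ∎

  δ-sym : ∀ {n} (a b : Fin n) → δ a b ≈ δ b a
  δ-sym Fin.zero    Fin.zero    = refl
  δ-sym Fin.zero    (Fin.suc b) = refl
  δ-sym (Fin.suc a) Fin.zero    = refl
  δ-sym (Fin.suc a) (Fin.suc b) = δ-sym a b

  δ-refl : ∀ {n} (a : Fin n) → δ a a ≈ 1#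
  δ-refl Fin.zero    = refl
  δ-refl (Fin.suc a) = δ-refl a

  ∑-δ-sym : ∀ {n} (a : Fin n) (f : Fin n → Carrier) → ∑ n (λ w → f w * δ w a) ≈ f a
  ∑-δ-sym {n} a f = trans
    (∑-cong n (λ w → trans (*-comm _ _) (*-congʳ (δ-sym w a))))
    (∑-δ a f)

  -- Deletion renumbers the remaining positions, so the summand has to depend on the list element
  -- and not on its index; `∑E` sums functions of edges for the same reason.
  ∑-removeAt : ∀ {a} {A : Set a} (xs : List A) (i : Fin (length xs)) (f : A → Carrier) →
    ∑ (length xs) (λ k → f (lookup xs k)) ≈
    f (lookup xs i) + ∑ (length (removeAt xs i)) (λ k → f (lookup (removeAt xs i) k))
  ∑-removeAt (x ∷ xs)     Fin.zero    f = refl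
  ∑-removeAt (x ∷ y ∷ xs) (Fin.suc i) f = trans
    (+-congˡ (∑-removeAt (y ∷ xs) i f))
    (solve 3 (λ a b c → a :+ (b :+ c) := b :+ (a :+ c)) refl _ _ _)

  lookup-removeAt : ∀ {a} {A : Set a} (xs : List A) (i : Fin (length xs))
    (j : Fin (length (removeAt xs i))) → ∃ λ k → lookup (removeAt xs i) j ≡ lookup xs k
  lookup-removeAt (x ∷ xs)     Fin.zero    j           = Fin.suc j , ≡.refl
  lookup-removeAt (x ∷ y ∷ xs) (Fin.suc i) Fin.zero    = Fin.zero , ≡.refl
  lookup-removeAt (x ∷ y ∷ xs) (Fin.suc i) (Fin.suc j) with lookup-removeAt (y ∷ xs) i j
  ... | k , eq = Fin.suc k , eq

  removeAt-or-kept : ∀ {a} {A : Set a} (xs : List A) (i k : Fin (length xs)) →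
    k ≡ i ⊎ ∃ λ j → lookup (removeAt xs i) j ≡ lookup xs k
  removeAt-or-kept (x ∷ xs)     Fin.zero    Fin.zero    = inj₁ ≡.refl
  removeAt-or-kept (x ∷ xs)     Fin.zero    (Fin.suc k) = inj₂ (k , ≡.refl)
  removeAt-or-kept (x ∷ y ∷ xs) (Fin.suc i) Fin.zero    = inj₂ (Fin.zero , ≡.refl)
  removeAt-or-kept (x ∷ y ∷ xs) (Fin.suc i) (Fin.suc k) with removeAt-or-kept (y ∷ xs) i k
  ... | inj₁ eq       = inj₁ (≡.cong Fin.suc eq)
  ... | inj₂ (j , eq) = inj₂ (Fin.suc j , eq)

  -- Order

  NonNeg : Carrier → Set _
  NonNeg x = 0# < x ⊎ x ≈ 0#

  pos⇒≉0 : ∀ {x} → 0# < x → ¬ x ≈ 0#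
  pos⇒≉0 0<x x≈0 = <.irrefl (sym x≈0) 0<x

  +-pos-nonNeg : ∀ {x y} → 0# < x → NonNeg y → 0# < x + y
  +-pos-nonNeg {x} {y} 0<x (inj₁ 0<y) =
    <.trans 0<y (<.<-respˡ-≈ (+-identityˡ y) (+-monoˡ-< y 0<x))
  +-pos-nonNeg 0<x (inj₂ y≈0) = <.<-respʳ-≈ (sym (trans (+-congˡ y≈0) (+-identityʳ _))) 0<x

  nonNeg-resp : ∀ {x y} → x ≈ y → NonNeg x → NonNeg y
  nonNeg-resp x≈y (inj₁ 0<x) = inj₁ (<.<-respʳ-≈ x≈y 0<x)
  nonNeg-resp x≈y (inj₂ x≈0) = inj₂ (trans (sym x≈y) x≈0)

  +-nonNeg : ∀ {x y} → NonNeg x → NonNeg y → NonNeg (x + y)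
  +-nonNeg (inj₁ 0<x) y≥0 = inj₁ (+-pos-nonNeg 0<x y≥0)
  +-nonNeg (inj₂ x≈0) y≥0 = nonNeg-resp (sym (trans (+-congʳ x≈0) (+-identityˡ _))) y≥0

  *-nonNeg : ∀ {x y} → NonNeg x → NonNeg y → NonNeg (x * y)
  *-nonNeg (inj₁ 0<x) (inj₁ 0<y) = inj₁ (*-pos 0<x 0<y)
  *-nonNeg (inj₂ x≈0) _          = inj₂ (trans (*-congʳ x≈0) (zeroˡ _))
  *-nonNeg (inj₁ _)   (inj₂ y≈0) = inj₂ (trans (*-congˡ y≈0) (zeroʳ _))

  ∑-nonNeg : ∀ n {f : Fin n → Carrier} → (∀ i → NonNeg (f i)) → NonNeg (∑ n f)
  ∑-nonNeg zero    f≥0 = inj₂ refl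
  ∑-nonNeg (suc n) f≥0 = +-nonNeg (f≥0 Fin.zero) (∑-nonNeg n (λ i → f≥0 (Fin.suc i)))

  neg⇒-pos : ∀ {x} → x < 0# → 0# < - x
  neg⇒-pos {x} x<0 = <.<-respˡ-≈ (-‿inverseʳ x) (<.<-respʳ-≈ (+-identityˡ (- x)) (+-monoˡ-< (- x) x<0))

  sq-nonNeg : ∀ x → NonNeg (x * x)
  sq-nonNeg x with <.compare 0# x
  ... | tri< 0<x _ _ = inj₁ (*-pos 0<x 0<x)
  ... | tri≈ _ 0≈x _ = inj₂ (trans (*-congʳ (sym 0≈x)) (zeroˡ x))
  ... | tri> _ _ x<0 = inj₁ (<.<-respʳ-≈
    (solve 1 (λ x → (:- x) :* (:- x) := x :* x) refl x)
    (*-pos (neg⇒-pos x<0) (neg⇒-pos x<0)))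

  ⁻¹-pos : ∀ {x} → 0# < x → 0# < x ⁻¹
  ⁻¹-pos {x} 0<x with <.compare 0# (x ⁻¹)
  ... | tri< 0<x⁻¹ _ _ = 0<x⁻¹
  ... | tri≈ _ 0≈x⁻¹ _ = contradiction
    (trans (sym (⁻¹-inverse x (pos⇒≉0 0<x))) (trans (*-congˡ (sym 0≈x⁻¹)) (zeroʳ x)))
    (pos⇒≉0 0<1)
  -- With a negative inverse, `1#` plus the product of `x` and `- x ⁻¹` would be positive, yet this
  -- sum is zero.
  ... | tri> _ _ x⁻¹<0 = contradiction
    (trans (+-congʳ (sym (⁻¹-inverse x (pos⇒≉0 0<x))))
      (solve 2 (λ x y → x :* y :+ x :* (:- y) := con (+ 0)) refl x (x ⁻¹)))
    (pos⇒≉0 (+-pos-nonNeg 0<1 (inj₁ (*-pos 0<x (neg⇒-pos x⁻¹<0)))))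

  fromℕ-suc : ∀ n → fromℕ n < fromℕ (suc n)
  fromℕ-suc n = <.<-respˡ-≈ (+-identityˡ _) (+-monoˡ-< (fromℕ n) 0<1)

  fromℕ-mono-< : ∀ {m n} → m ℕ.< n → fromℕ m < fromℕ n
  fromℕ-mono-< {m} {suc n} (ℕ.s≤s m≤n) with ℕ.m≤n⇒m<n∨m≡n m≤n
  ... | inj₁ m<n    = <.trans (fromℕ-mono-< m<n) (fromℕ-suc n)
  ... | inj₂ ≡.refl = fromℕ-suc m

  fromℕ-∸ : ∀ m n → n ℕ.≤ m → fromℕ (m ℕ.∸ n) ≈ fromℕ m - fromℕ n
  fromℕ-∸ m zero ℕ.z≤n = solve 1 (λ x → x := x :- con (+ 0)) refl (fromℕ m)
  fromℕ-∸ (suc m) (suc n) (ℕ.s≤s n≤m) = trans (fromℕ-∸ m n n≤m)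
    (solve 2 (λ x y → x :- y := (con (+ 1) :+ x) :- (con (+ 1) :+ y)) refl (fromℕ m) (fromℕ n))

  -- Voltages and Green functions

  ∑E : (G : MGraph) → (Edge (nv G) → Carrier) → Carrier
  ∑E G f = ∑ (nE G) (λ k → f (edge G k))

  ∑E-─ : ∀ G k f → ∑E G f ≈ f (edge G k) + ∑E (G ─ k) f
  ∑E-─ G = ∑-removeAt (edges G)

  drop : ∀ {n} → Edge n → (Fin n → Carrier) → Carrier
  drop e f = f (src e) - f (tgt e)

  -- The Dirichlet form of the circuit; on the diagonal it is the dissipated power.
  energy : (G : MGraph) (f h : Fin (nv G) → Carrier) → Carrier
  energy G f h = ∑E G (λ e → drop e f * drop e h * len e ⁻¹)

  energy-sym : ∀ G f h → energy G f h ≈ energy G h f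
  energy-sym G f h = ∑-cong (nE G) (λ k → *-congʳ (*-comm _ _))

  energy-nonNeg : ∀ G → PositiveLengths G → ∀ f → NonNeg (energy G f f)
  energy-nonNeg G L>0 f =
    ∑-nonNeg (nE G) (λ k → *-nonNeg (sq-nonNeg _) (inj₁ (⁻¹-pos (L>0 k))))

  ─-positive : ∀ G k → PositiveLengths G → PositiveLengths (G ─ k)
  ─-positive G k L>0 i with lookup-removeAt (edges G) k i
  ... | i′ , eq = ≡.subst (λ d → 0# < len d) (≡.sym eq) (L>0 i′)

  energy-minusʳ : ∀ G f h₁ h₂ → energy G f (λ x → h₁ x - h₂ x) ≈ energy G f h₁ - energy G f h₂
  energy-minusʳ G f h₁ h₂ = trans
    (∑-cong (nE G) (λ k → solve 6
      (λ f a b c d v → f :* ((a :- b) :- (c :- d)) :* v := f :* (a :- c) :* v :- f :* (b :- d) :* v)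
      refl _ _ _ _ _ _))
    (∑-- (nE G) _ _)

  current : ∀ {n} → Edge n → (Fin n → Carrier) → Fin n → Carrier
  current e f w =
    (δ (src e) w * (f (src e) - f (tgt e)) + δ (tgt e) w * (f (tgt e) - f (src e))) ÷ len e

  ∑-*-current : ∀ {n} (e : Edge n) h f →
    ∑ n (λ w → h w * current e f w) ≈ drop e h * drop e f * len e ⁻¹
  ∑-*-current {n} e h f = begin
    ∑ n (λ w → h w * current e f w)
      ≈⟨ ∑-cong n (λ w → solve 6
           (λ h a b x y v → h :* ((a :* (x :- y) :+ b :* (y :- x)) :* v)
                         := (a :* h :- b :* h) :* ((x :- y) :* v))
           refl (h w) (δ (src e) w) (δ (tgt e) w) (f (src e)) (f (tgt e)) (len e ⁻¹)) ⟩
    ∑ n (λ w → (δ (src e) w * h w - δ (tgt e) w * h w) * (drop e f * len e ⁻¹))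
      ≈⟨ ∑-*ʳ n _ _ ⟩
    ∑ n (λ w → δ (src e) w * h w - δ (tgt e) w * h w) * (drop e f * len e ⁻¹)
      ≈⟨ *-congʳ (∑-- n _ _) ⟩
    (∑ n (λ w → δ (src e) w * h w) - ∑ n (λ w → δ (tgt e) w * h w)) * (drop e f * len e ⁻¹)
      ≈⟨ *-congʳ (+-cong (∑-δ (src e) h) (-‿cong (∑-δ (tgt e) h))) ⟩
    drop e h * (drop e f * len e ⁻¹)
      ≈⟨ *-assoc _ _ _ ⟨
    drop e h * drop e f * len e ⁻¹ ∎

  -- Discrete integration by parts: regroup the sum over vertices by edges; each edge is seen only
  -- from its two ends.
  green-identity : ∀ G h f → ∑ (nv G) (λ w → h w * outflow G f w) ≈ energy G h f
  green-identity G h f = begin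
    ∑ (nv G) (λ w → h w * outflow G f w)
      ≈⟨ ∑-cong (nv G) (λ w → ∑-*ˡ (nE G) (h w) _) ⟨
    ∑ (nv G) (λ w → ∑ (nE G) (λ k → h w * current (edge G k) f w))
      ≈⟨ ∑-swap (nv G) (nE G) _ ⟩
    ∑ (nE G) (λ k → ∑ (nv G) (λ w → h w * current (edge G k) f w))
      ≈⟨ ∑-cong (nE G) (λ k → ∑-*-current (edge G k) h f) ⟩
    energy G h f ∎

  -- Riesz representation: a voltage represents, for the energy form, evaluation at the source minus
  -- evaluation at the sink. All later identities pair two potentials and evaluate the energy from
  -- either side.
  voltage-represents : ∀ G {z y} φ → IsVoltage G z y φ → ∀ f → energy G f φ ≈ f y - f z
  voltage-represents G {z} {y} φ (_ , out) f = begin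
    energy G f φ
      ≈⟨ green-identity G f φ ⟨
    ∑ (nv G) (λ w → f w * outflow G φ w)
      ≈⟨ ∑-cong (nv G) (λ w → trans (*-congˡ (out w))
           (solve 3 (λ f a b → f :* (a :- b) := f :* a :- f :* b) refl _ _ _)) ⟩
    ∑ (nv G) (λ w → f w * δ w y - f w * δ w z)
      ≈⟨ ∑-- (nv G) _ _ ⟩
    ∑ (nv G) (λ w → f w * δ w y) - ∑ (nv G) (λ w → f w * δ w z)
      ≈⟨ +-cong (∑-δ-sym y f) (-‿cong (∑-δ-sym z f)) ⟩
    f y - f z ∎

  Potential : ℕ → Set _
  Potential n = Fin n → Fin n → Carrier

  IsGreen : (G : MGraph) → Fin (nv G) → Potential (nv G) → Set _
  IsGreen G p g = ∀ y → IsVoltage G p y (λ x → g x y)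

  -- For a Green function `g`, the potential of a unit current that enters at the source of the edge
  -- and exits at its target, normalised to vanish at `p`.
  dipole : ∀ {n} → Potential n → Edge n → Fin n → Carrier
  dipole g e x = g x (src e) - g x (tgt e)

  resistance : ∀ {n} → Potential n → Edge n → Carrier
  resistance g e = drop e (dipole g e)

  yEdge : ∀ {n} → Potential n → Edge n → Carrier
  yEdge g e = (a * a + a * b + b * b) * len e ⁻¹
    where a = dipole g e (src e)
          b = dipole g e (tgt e)

  module Green (G : MGraph) {p : Fin (nv G)} {g : Potential (nv G)} (isGreen : IsGreen G p g) where

    represents : ∀ f y → energy G f (λ x → g x y) ≈ f y - f p
    represents f y = voltage-represents G (λ x → g x y) (isGreen y) f

    symmetric : ∀ x y → g x y ≈ g y x
    symmetric x y = begin
      g x y                                   ≈⟨ x-0 x y ⟨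
      g x y - g p y                           ≈⟨ represents (λ w → g w y) x ⟨
      energy G (λ w → g w y) (λ w → g w x)    ≈⟨ energy-sym G (λ w → g w y) (λ w → g w x) ⟩
      energy G (λ w → g w x) (λ w → g w y)    ≈⟨ represents (λ w → g w x) y ⟩
      g y x - g p x                           ≈⟨ x-0 y x ⟩
      g y x                                   ∎
      where
      x-0 : ∀ x y → g x y - g p y ≈ g x y
      x-0 x y = trans (+-congˡ (-‿cong (proj₁ (isGreen y))))
        (solve 1 (λ x → x :- con (+ 0) := x) refl _)

    dipole-p : ∀ e → dipole g e p ≈ 0#
    dipole-p e = trans (+-cong (proj₁ (isGreen _)) (-‿cong (proj₁ (isGreen _)))) (-‿inverseʳ 0#)

    dipole-drop : ∀ e x → dipole g e x ≈ drop e (λ w → g w x)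
    dipole-drop e x = +-cong (symmetric _ _) (-‿cong (symmetric _ _))

    drop-dipole-sym : ∀ e d → drop d (dipole g e) ≈ drop e (dipole g d)
    drop-dipole-sym e d = trans
      (+-cong (dipole-drop e (src d)) (-‿cong (dipole-drop e (tgt d))))
      (solve 4 (λ a b c d → (a :- b) :- (c :- d) := (a :- c) :- (b :- d)) refl _ _ _ _)

    dipole-represents : ∀ e f → energy G f (dipole g e) ≈ drop e f
    dipole-represents e f = begin
      energy G f (dipole g e)
        ≈⟨ energy-minusʳ G f (λ x → g x (src e)) (λ x → g x (tgt e)) ⟩
      energy G f (λ x → g x (src e)) - energy G f (λ x → g x (tgt e))
        ≈⟨ +-cong (represents f (src e)) (-‿cong (represents f (tgt e))) ⟩
      (f (src e) - f p) - (f (tgt e) - f p)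
        ≈⟨ solve 3 (λ a b c → (a :- c) :- (b :- c) := a :- b) refl _ _ _ ⟩
      drop e f ∎

    dipole-outflow : ∀ e w → outflow G (dipole g e) w ≈ δ w (src e) - δ w (tgt e)
    dipole-outflow e w = begin
      outflow G (dipole g e) w
        ≈⟨ ∑-cong (nE G) (λ k → solve 7
             (λ a b s₁ s₂ t₁ t₂ v →
               (a :* ((s₁ :- s₂) :- (t₁ :- t₂)) :+ b :* ((t₁ :- t₂) :- (s₁ :- s₂))) :* v
               := (a :* (s₁ :- t₁) :+ b :* (t₁ :- s₁)) :* v
                  :- (a :* (s₂ :- t₂) :+ b :* (t₂ :- s₂)) :* v)
             refl _ _ _ _ _ _ _) ⟩
      ∑ (nE G) (λ k → current (edge G k) (λ x → g x (src e)) w - current (edge G k) (λ x → g x (tgt e)) w)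
        ≈⟨ ∑-- (nE G) _ _ ⟩
      outflow G (λ x → g x (src e)) w - outflow G (λ x → g x (tgt e)) w
        ≈⟨ +-cong (proj₂ (isGreen (src e)) w) (-‿cong (proj₂ (isGreen (tgt e)) w)) ⟩
      (δ w (src e) - δ w p) - (δ w (tgt e) - δ w p)
        ≈⟨ solve 3 (λ a b c → (a :- c) :- (b :- c) := a :- b) refl _ _ _ ⟩
      δ w (src e) - δ w (tgt e) ∎

    -- Both sides are the trace of the Laplacian composed with the Green function. By edges it is
    -- the sum of r/L; by vertices every `w` contributes 1, except that the ground `p` contributes
    -- 0.
    foster : ∑E G (λ e → resistance g e * len e ⁻¹) ≈ fromℕ (nv G) - 1#
    foster = begin
      ∑E G (λ e → resistance g e * len e ⁻¹)
        ≈⟨ ∑-cong (nE G) (λ k → trace (edge G k)) ⟨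
      ∑ (nE G) (λ k → ∑ (nv G) (λ w → current (edge G k) (λ x → g x w) w))
        ≈⟨ ∑-swap (nE G) (nv G) _ ⟩
      ∑ (nv G) (λ w → outflow G (λ x → g x w) w)
        ≈⟨ ∑-cong (nv G) (λ w → trans (proj₂ (isGreen w) w) (+-congʳ (δ-refl w))) ⟩
      ∑ (nv G) (λ w → 1# - δ w p)
        ≈⟨ ∑-- (nv G) _ _ ⟩
      ∑ (nv G) (λ _ → 1#) - ∑ (nv G) (λ w → δ w p)
        ≈⟨ +-cong (∑-one (nv G)) (-‿cong (trans
             (∑-cong (nv G) (λ w → sym (*-identityˡ _))) (∑-δ-sym p (λ _ → 1#)))) ⟩
      fromℕ (nv G) - 1# ∎
      where
      trace : ∀ e → ∑ (nv G) (λ w → current e (λ x → g x w) w) ≈ resistance g e * len e ⁻¹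
      trace e = begin
        ∑ (nv G) (λ w → current e (λ x → g x w) w)
          ≈⟨ ∑-cong (nv G) (λ w → solve 5
               (λ a b x y v → (a :* (x :- y) :+ b :* (y :- x)) :* v := (a :* (x :- y) :- b :* (x :- y)) :* v)
               refl (δ (src e) w) (δ (tgt e) w) (g (src e) w) (g (tgt e) w) (len e ⁻¹)) ⟩
        ∑ (nv G) (λ w → (δ (src e) w * h w - δ (tgt e) w * h w) * len e ⁻¹)
          ≈⟨ trans (∑-*ʳ (nv G) _ _) (*-congʳ (∑-- (nv G) _ _)) ⟩
        (∑ (nv G) (λ w → δ (src e) w * h w) - ∑ (nv G) (λ w → δ (tgt e) w * h w)) * len e ⁻¹
          ≈⟨ *-congʳ (+-cong (∑-δ (src e) h) (-‿cong (∑-δ (tgt e) h))) ⟩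
        (h (src e) - h (tgt e)) * len e ⁻¹
          ≈⟨ *-congʳ (solve 4 (λ a b c d → (a :- b) :- (c :- d) := (a :- c) :- (b :- d)) refl _ _ _ _) ⟩
        resistance g e * len e ⁻¹ ∎
        where h = λ w → g (src e) w - g (tgt e) w

    resistance-nonNeg : PositiveLengths G → ∀ e → NonNeg (resistance g e)
    resistance-nonNeg L>0 e =
      nonNeg-resp (dipole-represents e (dipole g e)) (energy-nonNeg G L>0 (dipole g e))

    -- A resolution of the identity. By the symmetry of `g`, the coefficient of each edge is the
    -- drop of `dipole g d` along it and the other factor is the drop of `g` at `x`, so the sum is
    -- an energy that `represents` evaluates.
    dipole-completeness : ∀ d x →
      ∑E G (λ e → drop d (dipole g e) * dipole g e x * len e ⁻¹) ≈ dipole g d x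
    dipole-completeness d x = begin
      ∑E G (λ e → drop d (dipole g e) * dipole g e x * len e ⁻¹)
        ≈⟨ ∑-cong (nE G) (λ k → *-congʳ (*-cong (drop-dipole-sym (edge G k) d) (dipole-drop (edge G k) x))) ⟩
      energy G (dipole g d) (λ w → g w x)
        ≈⟨ represents (dipole g d) x ⟩
      dipole g d x - dipole g d p
        ≈⟨ trans (+-congˡ (-‿cong (dipole-p d))) (solve 1 (λ x → x :- con (+ 0) := x) refl _) ⟩
      dipole g d x ∎

    -- Comparison with the circuit without one edge

    module WithoutEdge (k : Fin (nE G)) (V : VoltageFn (G ─ k))
                       (L>0 : PositiveLengths G) where

      private
        e = edge G k
        s = src e
        t = tgt e
        L = len e
        v = L ⁻¹
        r = resistance g e
        R = Rk G k V
        D = Rak G p k V - Rbk G p k V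
        H = G ─ k
        j = proj₁ V

      -- The fraction of a unit current entering at one end of e and leaving at the other
      -- that bypasses e.
      bypass : Carrier
      bypass = 1# - r * v

      V-represents : ∀ z y f → energy H f (λ x → j z x y) ≈ f y - f z
      V-represents z y = voltage-represents H (λ x → j z x y) (proj₂ V z y)

      -- The energy of the dipole against a voltage of `H` is evaluated twice: in `H` by the
      -- voltage, and in `G` by the dipole after removing the contribution of `e`. This is the
      -- bridge between `g` and the data of the deleted graph.
      potential-difference : ∀ z y → dipole g e y - dipole g e z ≈ bypass * drop e (λ x → j z x y)
      potential-difference z y = begin
        dipole g e y - dipole g e z
          ≈⟨ V-represents z y (dipole g e) ⟨
        energy H (dipole g e) φ
          ≈⟨ energy-sym H (dipole g e) φ ⟩
        energy H φ (dipole g e)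
          ≈⟨ solve 2 (λ a b → b := (a :+ b) :- a) refl (drop e φ * r * v) _ ⟩
        (drop e φ * r * v + energy H φ (dipole g e)) - drop e φ * r * v
          ≈⟨ +-congʳ (∑E-─ G k (λ d → drop d φ * drop d (dipole g e) * len d ⁻¹)) ⟨
        energy G φ (dipole g e) - drop e φ * r * v
          ≈⟨ +-congʳ (dipole-represents e φ) ⟩
        drop e φ - drop e φ * r * v
          ≈⟨ solve 3 (λ f r v → f :- f :* r :* v := (con (+ 1) :- r :* v) :* f) refl _ _ _ ⟩
        bypass * drop e φ ∎
        where φ = λ x → j z x y

      reciprocity : ∀ z x y → j z x y ≈ j z y x
      reciprocity z x y = begin
        j z x y                                 ≈⟨ minus-zero x y ⟨
        j z x y - j z z y                       ≈⟨ V-represents z x (λ w → j z w y) ⟨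
        energy H (λ w → j z w y) (λ w → j z w x) ≈⟨ energy-sym H (λ w → j z w y) (λ w → j z w x) ⟩
        energy H (λ w → j z w x) (λ w → j z w y) ≈⟨ V-represents z y (λ w → j z w x) ⟩
        j z y x - j z z x                       ≈⟨ minus-zero y x ⟩
        j z y x                                 ∎
        where
        minus-zero : ∀ x y → j z x y - j z z y ≈ j z x y
        minus-zero x y = trans (+-congˡ (-‿cong (proj₁ (proj₂ V z y))))
          (solve 1 (λ x → x :- con (+ 0) := x) refl _)

      resistance-bypass : r ≈ bypass * R
      resistance-bypass = trans (potential-difference t s) (*-congˡ
        (trans (+-congˡ (-‿cong (proj₁ (proj₂ V t s)))) (solve 1 (λ x → x :- con (+ 0) := x) refl _)))

      -- Since the dipole vanishes at `p`, injecting at `p` with the ground at `s` gives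
      -- `dipole g e s` as `bypass` times R_a, and with the ground at `t` gives `dipole g e t` as
      -- minus `bypass` times R_b. Reciprocity turns j_s(t,p) into the j_s(p,t) of the definition of
      -- R_a.
      sum-bypass : dipole g e s + dipole g e t ≈ bypass * D
      sum-bypass = begin
        dipole g e s + dipole g e t
          ≈⟨ solve 3 (λ a b c → a :+ b := (c :+ c) :- ((c :- a) :+ (c :- b))) refl _ _ (dipole g e p) ⟩
        (dipole g e p + dipole g e p)
          - ((dipole g e p - dipole g e s) + (dipole g e p - dipole g e t))
          ≈⟨ +-cong (+-cong (dipole-p e) (dipole-p e))
               (-‿cong (+-cong (potential-difference s p) (potential-difference t p))) ⟩
        (0# + 0#) - (bypass * (j s s p - j s t p) + bypass * (j t s p - j t t p))
          ≈⟨ +-congˡ (-‿cong (+-cong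
               (*-congˡ (+-cong (proj₁ (proj₂ V s p)) (-‿cong (reciprocity s t p))))
               (*-congˡ (+-congˡ (-‿cong (proj₁ (proj₂ V t p))))))) ⟩
        (0# + 0#) - (bypass * (0# - j s p t) + bypass * (j t s p - 0#))
          ≈⟨ solve 3 (λ c a b → (con (+ 0) :+ con (+ 0))
               :- (c :* (con (+ 0) :- a) :+ c :* (b :- con (+ 0))) := c :* (a :- b)) refl _ _ _ ⟩
        bypass * D ∎

      -- R is the energy of its own voltage. This makes `L + R` positive, so that its total inverse
      -- is a true one.
      R-nonNeg : NonNeg R
      R-nonNeg = nonNeg-resp
        (begin
          energy H φ φ    ≈⟨ V-represents t s φ ⟩
          R - φ t         ≈⟨ +-congˡ (-‿cong (proj₁ (proj₂ V t s))) ⟩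
          R - 0#          ≈⟨ solve 1 (λ x → x :- con (+ 0) := x) refl _ ⟩
          R               ∎)
        (energy-nonNeg H (─-positive G k L>0) φ)
        where φ = λ x → j t x s

      L*v : L * v ≈ 1#
      L*v = ⁻¹-inverse L (pos⇒≉0 (L>0 k))

      private
        M = L + R
        u = M ⁻¹

      M>0 : 0# < M
      M>0 = +-pos-nonNeg (L>0 k) R-nonNeg

      M*u : M * u ≈ 1#
      M*u = ⁻¹-inverse M (pos⇒≉0 M>0)

      -- `bypass * L` is `L - r` and `bypass * R` is `r`, so `bypass * M` is `L`.
      L÷M : L ÷ M ≈ bypass
      L÷M = begin
        L * u
          ≈⟨ *-congʳ (solve 3 (λ L r v → L := r :+ (L :- r :* con (+ 1))) refl L r v) ⟩
        (r + (L - r * 1#)) * u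
          ≈⟨ *-congʳ (+-cong resistance-bypass (+-congˡ (-‿cong (*-congˡ (sym L*v))))) ⟩
        (bypass * R + (L - r * (L * v))) * u
          ≈⟨ solve 5 (λ R L r v u → ((con (+ 1) :- r :* v) :* R :+ (L :- r :* (L :* v))) :* u
               := (con (+ 1) :- r :* v) :* ((L :+ R) :* u)) refl R L r v u ⟩
        bypass * (M * u)
          ≈⟨ trans (*-congˡ M*u) (*-identityʳ _) ⟩
        bypass ∎

      bypass-nonNeg : NonNeg bypass
      bypass-nonNeg = nonNeg-resp L÷M (inj₁ (*-pos (L>0 k) (⁻¹-pos M>0)))

      -- Permits the division by `bypass` in the deletion update. For a bridge, `r` would equal `L`
      -- and the fraction would vanish.
      bypass≉0 : ¬ bypass ≈ 0#
      bypass≉0 c≈0 = pos⇒≉0 (*-pos (L>0 k) (⁻¹-pos M>0)) (trans L÷M c≈0)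

      sqM⁻¹ : sq M ⁻¹ ≈ u * u
      sqM⁻¹ = begin
        sq M ⁻¹                            ≈⟨ trans (*-identityʳ _) (*-identityʳ _) ⟨
        sq M ⁻¹ * 1# * 1#                  ≈⟨ *-cong (*-congˡ M*u) M*u ⟨
        sq M ⁻¹ * (M * u) * (M * u)        ≈⟨ solve 3 (λ w M u → w :* (M :* u) :* (M :* u)
                                                := ((M :* M) :* w) :* (u :* u)) refl _ _ _ ⟩
        (sq M * sq M ⁻¹) * (u * u)         ≈⟨ *-congʳ (⁻¹-inverse _ (pos⇒≉0 (*-pos M>0 M>0))) ⟩
        1# * (u * u)                       ≈⟨ *-identityˡ _ ⟩
        u * u                              ∎

      -- Used for both quadratic summands: with `X` the resistance R and with `X` the difference of
      -- R_a and R_b.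
      quadratic-term : ∀ {x X} → x ≈ bypass * X → (L * sq X) ÷ sq M ≈ x * x * v
      quadratic-term {x} {X} x≈ = begin
        (L * (X * X)) * sq M ⁻¹              ≈⟨ *-congˡ sqM⁻¹ ⟩
        (L * (X * X)) * (u * u)              ≈⟨ *-identityʳ _ ⟨
        (L * (X * X)) * (u * u) * 1#         ≈⟨ *-congˡ L*v ⟨
        (L * (X * X)) * (u * u) * (L * v)    ≈⟨ solve 4 (λ L X u v → (L :* (X :* X)) :* (u :* u) :* (L :* v)
                                                  := ((L :* u) :* X) :* ((L :* u) :* X) :* v) refl L X u v ⟩
        (L * u * X) * (L * u * X) * v        ≈⟨ *-congʳ (*-cong x≈′ x≈′) ⟩
        x * x * v                            ∎
        where x≈′ = trans (*-congʳ L÷M) (sym x≈)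

      linear-term : (sq L * R) ÷ sq M ≈ r - r * r * v
      linear-term = begin
        (L * L * R) * sq M ⁻¹      ≈⟨ *-congˡ sqM⁻¹ ⟩
        (L * L * R) * (u * u)      ≈⟨ solve 3 (λ L R u → (L :* L :* R) :* (u :* u)
                                        := ((L :* u) :* R) :* (L :* u)) refl _ _ _ ⟩
        (L * u * R) * (L * u)      ≈⟨ *-cong (trans (*-congʳ L÷M) (sym resistance-bypass)) L÷M ⟩
        r * bypass                 ≈⟨ solve 2 (λ r v → r :* (con (+ 1) :- r :* v) := r :- r :* r :* v) refl _ _ ⟩
        r - r * r * v              ∎

  -- The quarter coefficients

  4*¼ : fromℕ 4 * ¼ ≈ 1#
  4*¼ = ⁻¹-inverse (fromℕ 4) (pos⇒≉0 (fromℕ-mono-< {0} {4} (ℕ.s≤s ℕ.z≤n)))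

  -- The solver treats `¼` as an atom. The numerals are spelled exactly as `fromℕ` unfolds, so that
  -- `¾` matches by computation and four quarters can later be collected into `fromℕ 4 * ¼`.
  quarters : ∀ x y → ¼ * x + ¾ * y ≈ (x + (1# + (1# + 1#)) * y) * ¼
  quarters x y = solve 3 (λ x y h → h :* x
      :+ ((con (+ 1) :+ (con (+ 1) :+ (con (+ 1) :+ con (+ 0)))) :* h) :* y
      := (x :+ (con (+ 1) :+ (con (+ 1) :+ con (+ 1))) :* y) :* h) refl x y ¼

  yTerm-voltage : ∀ a b v → ¼ * ((a - b) * (a - b) * v) + ¾ * ((a + b) * (a + b) * v)
                  ≈ (a * a + a * b + b * b) * v
  yTerm-voltage a b v = begin
    ¼ * ((a - b) * (a - b) * v) + ¾ * ((a + b) * (a + b) * v)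
      ≈⟨ quarters _ _ ⟩
    ((a - b) * (a - b) * v + (1# + (1# + 1#)) * ((a + b) * (a + b) * v)) * ¼
      ≈⟨ solve 4 (λ a b v h → ((a :- b) :* (a :- b) :* v
             :+ (con (+ 1) :+ (con (+ 1) :+ con (+ 1))) :* ((a :+ b) :* (a :+ b) :* v)) :* h
           := ((con (+ 1) :+ (con (+ 1) :+ (con (+ 1) :+ (con (+ 1) :+ con (+ 0))))) :* h)
             :* ((a :* a :+ a :* b :+ b :* b) :* v)) refl a b v ¼ ⟩
    (fromℕ 4 * ¼) * ((a * a + a * b + b * b) * v)
      ≈⟨ trans (*-congʳ 4*¼) (*-identityˡ _) ⟩
    (a * a + a * b + b * b) * v ∎

  quarters-sum : ∀ x → ¼ * x + ¾ * x ≈ x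
  quarters-sum x = begin
    ¼ * x + ¾ * x
      ≈⟨ solve 2 (λ x h → h :* x :+ ((con (+ 1) :+ (con (+ 1) :+ (con (+ 1) :+ con (+ 0)))) :* h) :* x
           := ((con (+ 1) :+ (con (+ 1) :+ (con (+ 1) :+ (con (+ 1) :+ con (+ 0))))) :* h) :* x) refl x ¼ ⟩
    (fromℕ 4 * ¼) * x
      ≈⟨ trans (*-congʳ 4*¼) (*-identityˡ _) ⟩
    x ∎

  xEdge : ∀ {n} → Potential n → Edge n → Carrier
  xEdge g e = resistance g e - yEdge g e

  -- Reachability and bridges

  Reach-trans : ∀ {G a b d} → Reach G a b → Reach G b d → Reach G a d
  Reach-trans here           q = q
  Reach-trans (fwd k eq p)   q = fwd k eq (Reach-trans p q)
  Reach-trans (bwd k eq p)   q = bwd k eq (Reach-trans p q)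

  Reach-sym : ∀ {G a b} → Reach G a b → Reach G b a
  Reach-sym here              = here
  Reach-sym (fwd k ≡.refl p)  = Reach-trans (Reach-sym p) (bwd k ≡.refl here)
  Reach-sym (bwd k ≡.refl p)  = Reach-trans (Reach-sym p) (fwd k ≡.refl here)

  -- Every passage along the deleted edge is replaced by the detour. Contrapositively, the ends of a
  -- disconnecting edge of a connected graph cannot reach each other without it.
  Reach-─ : ∀ G k → Reach (G ─ k) (src (edge G k)) (tgt (edge G k)) →
            ∀ {a b} → Reach G a b → Reach (G ─ k) a b
  Reach-─ G k detour = go
    where
    step : ∀ i → Reach (G ─ k) (src (edge G i)) (tgt (edge G i))
    step i with removeAt-or-kept (edges G) k i
    ... | inj₁ ≡.refl   = detour
    ... | inj₂ (j , eq) = ≡.subst (λ e → Reach (G ─ k) (src e) (tgt e)) eq (fwd j ≡.refl here)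
    go : ∀ {a b} → Reach G a b → Reach (G ─ k) a b
    go here             = here
    go (fwd i ≡.refl p) = Reach-trans (step i) (go p)
    go (bwd i ≡.refl p) = Reach-trans (Reach-sym (step i)) (go p)

  -- Trichotomy decides equality, so an equation may be proved by a classical argument.
  ≈-stable : ∀ {x y} → ¬ ¬ x ≈ y → x ≈ y
  ≈-stable {x} {y} = decidable-stable (x <.≟ y)

  -- The summands of x and y through the Green function

  module Terms (G : MGraph) (L>0 : PositiveLengths G) (connected : Connected G)
               {p : Fin (nv G)} {g : Potential (nv G)} (isGreen : IsGreen G p g) where
    open Green G isGreen

    -- Up to a constant, the dipole potential of a bridge is its length times the indicator
    -- function of one of the two components that remain without it.
    bridge : ∀ k → ¬ Connected (G ─ k) →
             ¬ ¬ (resistance g (edge G k) ≈ len (edge G k) × yEdge g (edge G k) ≈ len (edge G k))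
    bridge k disconnected = ¬¬-map from-decision
      -- Reachability from `s` is not decided outright, but over finitely many vertices the doubly
      -- negated instances of excluded middle combine into a single doubly negated decision.
      (sequence (RawMonad.rawApplicative ¬¬-Monad) (λ _ → ¬¬-excluded-middle))
      where
      e = edge G k
      s = src e
      t = tgt e
      L = len e
      v = L ⁻¹
      H = G ─ k
      L*v : L * v ≈ 1#
      L*v = ⁻¹-inverse L (pos⇒≉0 (L>0 k))
      from-decision : (∀ w → Dec (Reach H s w)) → resistance g e ≈ L × yEdge g e ≈ L
      from-decision reach? = (begin
          a - b                                ≈⟨ +-cong a≈ (-‿cong b≈) ⟩
          L * (1# - χ p) - L * (0# - χ p)      ≈⟨ solve 2 (λ L x → L :* (con (+ 1) :- x) :- L :* (con (+ 0) :- x) := L) refl L (χ p) ⟩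
          L                                    ∎) ,
        (begin
          (a * a + a * b + b * b) * v
            ≈⟨ *-congʳ (+-cong (+-cong (*-cong a≈ a≈) (*-cong a≈ b≈)) (*-cong b≈ b≈)) ⟩
          (L * (1# - χ p) * (L * (1# - χ p)) + L * (1# - χ p) * (L * (0# - χ p))
             + L * (0# - χ p) * (L * (0# - χ p))) * v
            ≈⟨ solve 3 (λ L x v → (L :* (con (+ 1) :- x) :* (L :* (con (+ 1) :- x))
                 :+ L :* (con (+ 1) :- x) :* (L :* (con (+ 0) :- x))
                 :+ L :* (con (+ 0) :- x) :* (L :* (con (+ 0) :- x))) :* v
                 := (L :* v) :* L :* (con (+ 1) :+ con (+ 3) :* (x :* x :- x))) refl L (χ p) v ⟩
          -- As `χ p` is 0 or 1, the bracket is 1 on whichever side of the bridge `p` lies.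
          (L * v) * L * (1# + (1# + 1# + 1#) * (χ p * χ p - χ p))
            ≈⟨ *-cong (*-congʳ L*v) (+-congˡ (*-congˡ (+-congʳ (χ-idem p)))) ⟩
          1# * L * (1# + (1# + 1# + 1#) * (χ p - χ p))
            ≈⟨ solve 2 (λ L x → con (+ 1) :* L :* (con (+ 1) :+ con (+ 3) :* (x :- x)) := L) refl L (χ p) ⟩
          L ∎)
        where
        χ : Fin (nv G) → Carrier
        χ w = if does (reach? w) then 1# else 0#
        χ-reach : ∀ {w} → Reach H s w → χ w ≈ 1#
        χ-reach {w} path with reach? w
        ... | yes _ = refl
        ... | no ¬path = contradiction path ¬path
        χ-unreach : ∀ {w} → ¬ Reach H s w → χ w ≈ 0#
        χ-unreach {w} ¬path with reach? w
        ... | yes path = contradiction path ¬path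
        ... | no _ = refl
        χ-idem : ∀ w → χ w * χ w ≈ χ w
        χ-idem w with reach? w
        ... | yes _ = *-identityˡ 1#
        ... | no  _ = zeroˡ 0#
        χ-drop : ∀ i → drop (edge H i) χ ≈ 0#
        χ-drop i with reach? (src (edge H i)) | reach? (tgt (edge H i))
        ... | yes _    | yes _    = -‿inverseʳ 1#
        ... | no  _    | no  _    = -‿inverseʳ 0#
        ... | yes path | no ¬path = contradiction (Reach-trans path (fwd i ≡.refl here)) ¬path
        ... | no ¬path | yes path = contradiction (Reach-trans path (bwd i ≡.refl here)) ¬path
        ¬s-t : ¬ Reach H s t
        ¬s-t path = disconnected (λ a b → Reach-─ G k path (connected a b))
        a = dipole g e s
        b = dipole g e t
        -- No surviving edge joins the two sides, so `χ` has a drop only along `e`. Its energy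
        -- against `φ` is therefore a single term, and `represents` evaluates the same energy as a
        -- difference of values of `χ`.
        dipole-χ : ∀ y → dipole g e y ≈ L * (χ y - χ p)
        dipole-χ y = begin
          dipole g e y
            ≈⟨ dipole-drop e y ⟩
          drop e φ
            ≈⟨ trans (*-congʳ L*v) (*-identityˡ _) ⟨
          (L * v) * drop e φ
            ≈⟨ solve 3 (λ L v d → (L :* v) :* d
                 := L :* ((con (+ 1) :- con (+ 0)) :* d :* v :+ con (+ 0))) refl L v (drop e φ) ⟩
          L * ((1# - 0#) * drop e φ * v + 0#)
            ≈⟨ *-congˡ (+-cong
                 (*-congʳ (*-congʳ (+-cong (χ-reach here) (-‿cong (χ-unreach ¬s-t)))))
                 (trans (∑-cong (nE H) (λ i → trans (*-congʳ (*-congʳ (χ-drop i)))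
                          (trans (*-congʳ (zeroˡ _)) (zeroˡ _))))
                        (∑-zero (nE H)))) ⟨
          L * (drop e χ * drop e φ * v + energy H χ φ)
            ≈⟨ *-congˡ (∑E-─ G k (λ d → drop d χ * drop d φ * len d ⁻¹)) ⟨
          L * energy G χ φ
            ≈⟨ *-congˡ (represents χ y) ⟩
          L * (χ y - χ p) ∎
          where φ = λ x → g x y
        a≈ : a ≈ L * (1# - χ p)
        a≈ = trans (dipole-χ s) (*-congˡ (+-congʳ (χ-reach here)))
        b≈ : b ≈ L * (0# - χ p)
        b≈ = trans (dipole-χ t) (*-congˡ (+-congʳ (χ-unreach ¬s-t)))

    yTerm-≈ : ∀ k d → yTerm G p k d ≈ yEdge g (edge G k)
    yTerm-≈ k (inj₁ disconnected) = ≈-stable (¬¬-map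
      (λ (_ , y≈L) → trans (quarters-sum _) (sym y≈L)) (bridge k disconnected))
    yTerm-≈ k (inj₂ V) = trans
      (+-cong (*-congˡ (quadratic-term resistance-bypass)) (*-congˡ (quadratic-term sum-bypass)))
      (yTerm-voltage _ _ _)
      where open WithoutEdge k V L>0

    xTerm-≈ : ∀ k d → xTerm G p k d ≈ xEdge g (edge G k)
    xTerm-≈ k (inj₁ disconnected) = ≈-stable (¬¬-map
      (λ (r≈L , y≈L) → trans
        (solve 2 (λ x L → (con (+ 0) :+ x) :- x := L :- L) refl _ _)
        (sym (+-cong r≈L (-‿cong y≈L))))
      (bridge k disconnected))
    xTerm-≈ k (inj₂ V) = begin
      xTerm G p k (inj₂ V)
        ≈⟨ +-cong (+-cong linear-term (*-congˡ (quadratic-term resistance-bypass)))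
             (-‿cong (*-congˡ (quadratic-term sum-bypass))) ⟩
      (r - r²v) + ¾ * r²v - ¾ * s²v
        ≈⟨ +-congʳ (+-congʳ (+-congˡ (-‿cong (quarters-sum r²v)))) ⟨
      -- Splitting `r²v` lets its three quarters cancel the middle sum of x; what is subtracted from
      -- `r` is then exactly the y summand.
      (r - (¼ * r²v + ¾ * r²v)) + ¾ * r²v - ¾ * s²v
        ≈⟨ solve 4 (λ r a b c → (r :- (a :+ b)) :+ b :- c := r :- (a :+ c)) refl _ _ _ _ ⟩
      r - (¼ * r²v + ¾ * s²v)
        ≈⟨ +-congˡ (-‿cong (yTerm-voltage _ _ _)) ⟩
      xEdge g e ∎
      where
      open WithoutEdge k V L>0
      e = edge G k
      r = resistance g e
      v = len e ⁻¹
      r²v = r * r * v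
      s²v = (dipole g e (src e) + dipole g e (tgt e)) * (dipole g e (src e) + dipole g e (tgt e)) * v

    yval-≈ : ∀ d → yval G p d ≈ ∑E G (yEdge g)
    yval-≈ d = ∑-cong (nE G) (λ k → yTerm-≈ k (d k))

    xval-≈ : ∀ d → xval G p d ≈ ∑E G (resistance g) - ∑E G (yEdge g)
    xval-≈ d = trans (∑-cong (nE G) (λ k → xTerm-≈ k (d k))) (∑-- (nE G) _ _)

  -- Rank-one updates of the Green function

  module _ (G : MGraph) {p : Fin (nv G)} {g : Potential (nv G)} (isGreen : IsGreen G p g)
           (es : List (Edge (nv G))) (e : Edge (nv G)) where
    open Green G isGreen

    -- The Sherman-Morrison formula for a change of the conductance between the ends of `e` by `σ`.
    -- The sign of `σ` is free, so the lemma covers both restoring and deleting an edge.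
    rank-one-update : ∀ σ κ → κ * (1# + σ * resistance g e) ≈ σ →
      let G′ = record { nv = nv G ; edges = es } in
      (∀ f w → outflow G′ f w ≈ outflow G f w + (δ w (src e) - δ w (tgt e)) * (σ * drop e f)) →
      IsGreen G′ p (λ x y → g x y - κ * (dipole g e x * dipole g e y))
    rank-one-update σ κ κ≈ outflow′ y =
      (begin
        g p y - κ * (dipole g e p * dipole g e y)
          ≈⟨ +-cong (proj₁ (isGreen y)) (-‿cong (*-congˡ (*-congʳ (dipole-p e)))) ⟩
        0# - κ * (0# * dipole g e y)
          ≈⟨ solve 2 (λ κ x → con (+ 0) :- κ :* (con (+ 0) :* x) := con (+ 0)) refl _ _ ⟩
        0# ∎) ,
      λ w → begin
        outflow G′ g′ w
          ≈⟨ outflow′ g′ w ⟩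
        outflow G g′ w + B w * (σ * drop e g′)
          ≈⟨ +-cong (outflow-g′ w) (*-congˡ (*-congˡ drop-g′)) ⟩
        (outflow G (λ x → g x y) w - γ * outflow G ψ w) + B w * (σ * (ψ y - γ * r))
          ≈⟨ +-congʳ (+-cong (proj₂ (isGreen y) w) (-‿cong (*-congˡ (dipole-outflow e w)))) ⟩
        (A w - γ * B w) + B w * (σ * (ψ y - γ * r))
          ≈⟨ solve 6 (λ a κ ψ b σ r → (a :- κ :* ψ :* b) :+ b :* (σ :* (ψ :- κ :* ψ :* r))
               := a :+ b :* ψ :* (σ :- κ :* (con (+ 1) :+ σ :* r))) refl (A w) κ (ψ y) (B w) σ r ⟩
        A w + B w * ψ y * (σ - κ * (1# + σ * r))
          ≈⟨ +-congˡ (*-congˡ (+-congˡ (-‿cong κ≈))) ⟩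
        A w + B w * ψ y * (σ - σ)
          ≈⟨ solve 3 (λ a b σ → a :+ b :* (σ :- σ) := a) refl _ _ _ ⟩
        A w ∎
      where
      G′ = record { nv = nv G ; edges = es }
      ψ = dipole g e
      r = resistance g e
      γ = κ * ψ y
      A = λ w → δ w y - δ w p
      B = λ w → δ w (src e) - δ w (tgt e)
      g′ = λ x → g x y - κ * (ψ x * ψ y)
      drop-g′ : drop e g′ ≈ ψ y - γ * r
      drop-g′ = trans
        (solve 6 (λ a b κ s t y → (a :- κ :* (s :* y)) :- (b :- κ :* (t :* y))
          := (a :- b) :- κ :* y :* (s :- t)) refl _ _ κ _ _ (ψ y))
        (+-congʳ (sym (dipole-drop e y)))
      outflow-g′ : ∀ w → outflow G g′ w ≈ outflow G (λ x → g x y) w - γ * outflow G ψ w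
      outflow-g′ w = begin
        outflow G g′ w
          ≈⟨ ∑-cong (nE G) (λ k → solve 9
               (λ a b x₁ x₂ s t κ y v →
                 (a :* ((x₁ :- κ :* (s :* y)) :- (x₂ :- κ :* (t :* y)))
                   :+ b :* ((x₂ :- κ :* (t :* y)) :- (x₁ :- κ :* (s :* y)))) :* v
                 := (a :* (x₁ :- x₂) :+ b :* (x₂ :- x₁)) :* v
                    :- κ :* y :* ((a :* (s :- t) :+ b :* (t :- s)) :* v))
               refl _ _ _ _ _ _ κ (ψ y) _) ⟩
        ∑ (nE G) (λ k → current (edge G k) (λ x → g x y) w - γ * current (edge G k) ψ w)
          ≈⟨ trans (∑-- (nE G) _ _) (+-congˡ (-‿cong (∑-*ˡ (nE G) γ _))) ⟩
        outflow G (λ x → g x y) w - γ * outflow G ψ w ∎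

  outflow-─ : ∀ G k f w → let e = edge G k in
    outflow G f w ≈ outflow (G ─ k) f w + (δ w (src e) - δ w (tgt e)) * (len e ⁻¹ * drop e f)
  outflow-─ G k f w = begin
    outflow G f w
      ≈⟨ ∑E-─ G k (λ d → current d f w) ⟩
    current e f w + outflow (G ─ k) f w
      ≈⟨ +-congʳ (*-congʳ (+-cong (*-congʳ (δ-sym (src e) w)) (*-congʳ (δ-sym (tgt e) w)))) ⟩
    (δ w (src e) * (f (src e) - f (tgt e)) + δ w (tgt e) * (f (tgt e) - f (src e))) * len e ⁻¹
      + outflow (G ─ k) f w
      ≈⟨ solve 6 (λ a b x y v o → (a :* (x :- y) :+ b :* (y :- x)) :* v :+ o
           := o :+ (a :- b) :* (v :* (x :- y))) refl _ _ _ _ _ _ ⟩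
    outflow (G ─ k) f w + (δ w (src e) - δ w (tgt e)) * (len e ⁻¹ * drop e f) ∎
    where e = edge G k

  -- The given voltages grounded at `p` form a Green function of the graph without the edge;
  -- restoring the edge is the update with `σ` its conductance. The denominator is positive because
  -- effective resistances are nonnegative.
  green-from-─ : ∀ G → PositiveLengths G → ∀ k → VoltageFn (G ─ k) → ∀ p → ∃ (IsGreen G p)
  green-from-─ G L>0 k V p = (λ x y → g x y - v * (1# + v * r) ⁻¹ * (dipole g e x * dipole g e y)) ,
    rank-one-update (G ─ k) {g = g} isGreen (edges G) e v (v * (1# + v * r) ⁻¹)
      (trans (solve 3 (λ v c i → (v :* i) :* c := v :* (c :* i)) refl v (1# + v * r) ((1# + v * r) ⁻¹))
        (trans (*-congˡ (⁻¹-inverse _ 1+vr≉0)) (*-identityʳ v)))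
      (outflow-─ G k)
    where
    e = edge G k
    v = len e ⁻¹
    g : Potential (nv G)
    g = proj₁ V p
    isGreen : IsGreen (G ─ k) p g
    isGreen = proj₂ V p
    r = resistance g e
    1+vr≉0 : ¬ 1# + v * r ≈ 0#
    1+vr≉0 = pos⇒≉0 (+-pos-nonNeg 0<1 (*-nonNeg (inj₁ (⁻¹-pos (L>0 k)))
      (Green.resistance-nonNeg (G ─ k) {g = g} isGreen (─-positive G k L>0) e)))

  -- The effect of one deletion on resistances and on y

  module Deletion (Γ : MGraph) (L>0 : PositiveLengths Γ) {p : Fin (nv Γ)} {g : Potential (nv Γ)}
                  (isGreen : IsGreen Γ p g) (i : Fin (nE Γ)) (V : VoltageFn (Γ ─ i)) where
    open Green Γ isGreen
    open WithoutEdge i V L>0 using (bypass; bypass≉0)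

    private
      e = edge Γ i
      ψ = dipole g e
      v = len e ⁻¹
      r = resistance g e
      η = v * bypass ⁻¹
      a = ψ (src e)
      b = ψ (tgt e)

    bypass*η : bypass * η ≈ v
    bypass*η = trans (solve 3 (λ c v i → c :* (v :* i) := v :* (c :* i)) refl bypass v (bypass ⁻¹))
      (trans (*-congˡ (⁻¹-inverse _ bypass≉0)) (*-identityʳ v))

    g′ : Potential (nv Γ)
    g′ x y = g x y - (- η) * (ψ x * ψ y)

    -- Deletion amounts to adding a parallel edge of conductance `- v`; hence `κ` is `- η`, and `g′`
    -- keeps the double sign to match the general update.
    isGreen′ : IsGreen (Γ ─ i) p g′
    isGreen′ = rank-one-update Γ isGreen (edges (Γ ─ i)) e (- v) (- η)
      (trans (solve 3 (λ η v r → (:- η) :* (con (+ 1) :+ (:- v) :* r) := :- ((con (+ 1) :- r :* v) :* η)) refl η v r)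
        (-‿cong bypass*η))
      (λ f w → trans
        (solve 4 (λ o b v f → o := (o :+ b :* (v :* f)) :+ b :* ((:- v) :* f)) refl _ _ v _)
        (+-congʳ (sym (outflow-─ Γ i f w))))

    dipole-g′ : ∀ d x → dipole g′ d x ≈ dipole g d x + η * (ψ x * drop d ψ)
    dipole-g′ d x = solve 6 (λ a b η x s t →
      (a :- (:- η) :* (x :* s)) :- (b :- (:- η) :* (x :* t)) := (a :- b) :+ η :* (x :* (s :- t)))
      refl _ _ η (ψ x) _ _

    resistance-g′ : ∀ d → resistance g′ d ≈ resistance g d + η * (drop d ψ * drop d ψ)
    resistance-g′ d = trans
      (+-cong (dipole-g′ d (src d)) (-‿cong (dipole-g′ d (tgt d))))
      (solve 5 (λ a b η s t → (a :+ η :* (s :* (s :- t))) :- (b :+ η :* (t :* (s :- t)))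
        := (a :- b) :+ η :* ((s :- t) :* (s :- t))) refl _ _ η _ _)

    -- The polar form of a² + ab + b² at the dipoles of d and of the deleted edge, times drop d ψ.
    cross : Edge (nv Γ) → Carrier
    cross d = drop d ψ * ((s + s + t) * ψ (src d) + (s + t + t) * ψ (tgt d)) * len d ⁻¹
      where s = dipole g d (src d)
            t = dipole g d (tgt d)

    ψ³ : Fin (nv Γ) → Carrier
    ψ³ x = ψ x * ψ x * ψ x

    -- The quadratic part telescopes because (s − t)(s² + s t + t²) = s³ − t³.
    yEdge-g′ : ∀ d → yEdge g′ d ≈ (yEdge g d + η * cross d) + η * η * (drop d ψ³ * drop d ψ * len d ⁻¹)
    yEdge-g′ d = trans
      (*-congʳ (+-cong (+-cong (*-cong A A) (*-cong A B)) (*-cong B B)))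
      (solve 6 (λ a b η s t w →
        let a′ = a :+ η :* (s :* (s :- t))
            b′ = b :+ η :* (t :* (s :- t)) in
        (a′ :* a′ :+ a′ :* b′ :+ b′ :* b′) :* w
        := ((a :* a :+ a :* b :+ b :* b) :* w
             :+ η :* ((s :- t) :* ((a :+ a :+ b) :* s :+ (a :+ b :+ b) :* t) :* w))
           :+ η :* η :* ((s :* s :* s :- t :* t :* t) :* (s :- t) :* w))
        refl _ _ η _ _ _)
      where A = dipole-g′ d (src d)
            B = dipole-g′ d (tgt d)

    -- The update is summed over all of `Γ` and the term of `e` is then taken out. The factor
    -- `bypass` clears the denominator of `η`, and the leftovers `v * (r * r)` and `bypass * r` add
    -- up to `r`.
    bypass-resistance : bypass * ∑E (Γ ─ i) (resistance g′) ≈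
      bypass * ∑E Γ (resistance g) + v * ∑E Γ (λ d → drop d ψ * drop d ψ) - r
    bypass-resistance = begin
      bypass * ∑E (Γ ─ i) (resistance g′)
        ≈⟨ *-congˡ (solve 2 (λ x y → y := (x :+ y) :- x) refl (resistance g′ e) _) ⟩
      bypass * ((resistance g′ e + ∑E (Γ ─ i) (resistance g′)) - resistance g′ e)
        ≈⟨ *-congˡ (+-congʳ (∑E-─ Γ i (resistance g′))) ⟨
      bypass * (∑E Γ (resistance g′) - resistance g′ e)
        ≈⟨ *-congˡ (+-cong total (-‿cong (resistance-g′ e))) ⟩
      bypass * ((S + η * Q) - (r + η * (r * r)))
        ≈⟨ solve 5 (λ η r v S Q → (con (+ 1) :- r :* v) :* ((S :+ η :* Q) :- (r :+ η :* (r :* r)))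
             := (con (+ 1) :- r :* v) :* S :+ ((con (+ 1) :- r :* v) :* η) :* (Q :- r :* r)
                :- (con (+ 1) :- r :* v) :* r) refl η r v S Q ⟩
      bypass * S + (bypass * η) * (Q - r * r) - bypass * r
        ≈⟨ +-congʳ (+-congˡ (*-congʳ bypass*η)) ⟩
      bypass * S + v * (Q - r * r) - bypass * r
        ≈⟨ solve 4 (λ r v S Q → (con (+ 1) :- r :* v) :* S :+ v :* (Q :- r :* r)
                :- (con (+ 1) :- r :* v) :* r
             := (con (+ 1) :- r :* v) :* S :+ v :* Q :- r) refl r v S Q ⟩
      bypass * S + v * Q - r ∎
      where
      S = ∑E Γ (resistance g)
      Q = ∑E Γ (λ d → drop d ψ * drop d ψ)
      total : ∑E Γ (resistance g′) ≈ S + η * Q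
      total = trans (∑-cong (nE Γ) (λ k → resistance-g′ (edge Γ k)))
        (trans (∑-+ (nE Γ) _ _) (+-congˡ (∑-*ˡ (nE Γ) η _)))

    -- One factor `bypass` clears even the term quadratic in `η`: its sum over `Γ` collapses to the
    -- drop of `ψ³` along `e`, which is `r * q`, and this cancels against the summand of the deleted
    -- edge.
    bypass-y : bypass * ∑E (Γ ─ i) (yEdge g′) ≈
      bypass * ∑E Γ (yEdge g) + v * ∑E Γ cross - yEdge g e
    bypass-y = begin
      bypass * ∑E (Γ ─ i) (yEdge g′)
        ≈⟨ *-congˡ (solve 2 (λ x y → y := (x :+ y) :- x) refl (yEdge g′ e) _) ⟩
      bypass * ((yEdge g′ e + ∑E (Γ ─ i) (yEdge g′)) - yEdge g′ e)
        ≈⟨ *-congˡ (+-congʳ (∑E-─ Γ i (yEdge g′))) ⟨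
      bypass * (∑E Γ (yEdge g′) - yEdge g′ e)
        ≈⟨ *-congˡ (+-cong total (-‿cong (yEdge-g′ e))) ⟩
      bypass * (((Y + η * X) + η * η * drop e ψ³)
        - ((yEdge g e + η * cross e) + η * η * (drop e ψ³ * r * v)))
        ≈⟨ solve 6 (λ a b v η Y X →
             let q = a :* a :+ a :* b :+ b :* b
                 r = a :- b
                 c = con (+ 1) :- r :* v
                 z = a :* a :* a :- b :* b :* b in
             c :* (((Y :+ η :* X) :+ η :* η :* z)
               :- ((q :* v :+ η :* (r :* ((a :+ a :+ b) :* a :+ (a :+ b :+ b) :* b) :* v)) :+ η :* η :* (z :* r :* v)))
             := c :* Y :+ (c :* η) :* (X :+ η :* r :* q) :- q :* v :* (con (+ 1) :+ η :* r) :* (c :+ (c :* η) :* r))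
             refl a b v η Y X ⟩
      -- The update scales the dipole of `e` by `1# + η * r`, hence its y summand by the square. One
      -- of these factors times `bypass` becomes `bypass + v * r`, which is 1; the other leaves a
      -- term `q * v * η * r` that cancels.
      bypass * Y + (bypass * η) * (X + η * r * q) - q * v * (1# + η * r) * (bypass + (bypass * η) * r)
        ≈⟨ +-cong (+-congˡ (*-congʳ bypass*η)) (-‿cong (*-congˡ (+-congˡ (*-congʳ bypass*η)))) ⟩
      bypass * Y + v * (X + η * r * q) - q * v * (1# + η * r) * (bypass + v * r)
        ≈⟨ solve 6 (λ q r v η Y X →
             let c = con (+ 1) :- r :* v in
             c :* Y :+ v :* (X :+ η :* r :* q) :- q :* v :* (con (+ 1) :+ η :* r) :* (c :+ v :* r)
             := c :* Y :+ v :* X :- q :* v) refl q r v η Y X ⟩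
      bypass * Y + v * X - yEdge g e ∎
      where
      Y = ∑E Γ (yEdge g)
      X = ∑E Γ cross
      q = a * a + a * b + b * b
      total : ∑E Γ (yEdge g′) ≈ (Y + η * X) + η * η * drop e ψ³
      total = begin
        ∑E Γ (yEdge g′)
          ≈⟨ trans (∑-cong (nE Γ) (λ k → yEdge-g′ (edge Γ k))) (∑-+ (nE Γ) _ _) ⟩
        ∑E Γ (λ d → yEdge g d + η * cross d) + ∑E Γ (λ d → η * η * (drop d ψ³ * drop d ψ * len d ⁻¹))
          ≈⟨ +-cong (trans (∑-+ (nE Γ) _ _) (+-congˡ (∑-*ˡ (nE Γ) η _))) (∑-*ˡ (nE Γ) (η * η) _) ⟩
        (Y + η * X) + η * η * energy Γ ψ³ ψ
          ≈⟨ +-congˡ (*-congˡ (dipole-represents e ψ³)) ⟩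
        (Y + η * X) + η * η * drop e ψ³ ∎

  -- Summation over the deleted edges

  module Recursion (Γ : MGraph) (L>0 : PositiveLengths Γ) (connected : Connected Γ)
                   (bridgeless : Bridgeless Γ) {p : Fin (nv Γ)} {g : Potential (nv Γ)}
                   (isGreen : IsGreen Γ p g) (V : ∀ i → VoltageFn (Γ ─ i)) (D : ∀ i → ElecData (Γ ─ i)) where
    open Green Γ isGreen
    module At (i : Fin (nE Γ)) where
      open WithoutEdge i (V i) L>0 public using (bypass; bypass-nonNeg; L÷M)
      open Deletion Γ L>0 isGreen i (V i) public
      -- Bridgelessness enters as the connectedness of `Γ ─ i`, which the treatment of the bridges
      -- of that graph requires.
      open Terms (Γ ─ i) (─-positive Γ i L>0) (bridgeless i) {g = g′} isGreen′ public using (xval-≈; yval-≈)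
    open At using (bypass)

    private
      n = nE Γ
      Y = ∑E Γ (yEdge g)
      S = ∑E Γ (resistance g)
      X Q : Fin n → Carrier
      X i = len (edge Γ i) ⁻¹ * ∑E Γ (At.cross i)
      Q i = len (edge Γ i) ⁻¹ * ∑E Γ (λ d → drop d (dipole g (edge Γ i)) * drop d (dipole g (edge Γ i)))

    ∑-weighted-swap : ∀ (h : Fin n → Edge (nv Γ) → Carrier) →
      ∑ n (λ i → len (edge Γ i) ⁻¹ * ∑E Γ (h i)) ≈ ∑E Γ (λ d → ∑ n (λ i → h i d * len (edge Γ i) ⁻¹))
    ∑-weighted-swap h = trans
      (∑-cong n (λ i → trans (*-comm _ _) (sym (∑-*ʳ n _ _))))
      (∑-swap n n _)

    -- After the exchange of sums, completeness replaces the dipoles of the deleted edges by that of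
    -- `d`; a polar form on the diagonal is twice its quadratic form.
    ∑-cross : ∑ n X ≈ Y + Y
    ∑-cross = begin
      ∑ n X
        ≈⟨ ∑-weighted-swap At.cross ⟩
      ∑E Γ (λ d → ∑ n (λ i → At.cross i d * len (edge Γ i) ⁻¹))
        ≈⟨ ∑-cong n (λ k → at-edge (edge Γ k)) ⟩
      ∑E Γ (λ d → yEdge g d + yEdge g d)
        ≈⟨ ∑-+ n _ _ ⟩
      Y + Y ∎
      where
      at-edge : ∀ d → ∑ n (λ i → At.cross i d * len (edge Γ i) ⁻¹) ≈ yEdge g d + yEdge g d
      at-edge d = begin
        ∑ n (λ i → At.cross i d * len (edge Γ i) ⁻¹)
          ≈⟨ ∑-cong n (λ i → solve 7
               (λ f A B s t w v → (f :* (A :* s :+ B :* t) :* w) :* v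
                 := w :* (A :* (f :* s :* v)) :+ w :* (B :* (f :* t :* v)))
               refl _ A B _ _ w _) ⟩
        ∑ n (λ i → w * (A * f i (src d)) + w * (B * f i (tgt d)))
          ≈⟨ ∑-+ n _ _ ⟩
        ∑ n (λ i → w * (A * f i (src d))) + ∑ n (λ i → w * (B * f i (tgt d)))
          ≈⟨ +-cong (factor A (src d)) (factor B (tgt d)) ⟩
        w * (A * a) + w * (B * b)
          ≈⟨ solve 3 (λ a b w → w :* ((a :+ a :+ b) :* a) :+ w :* ((a :+ b :+ b) :* b)
               := (a :* a :+ a :* b :+ b :* b) :* w :+ (a :* a :+ a :* b :+ b :* b) :* w) refl a b w ⟩
        yEdge g d + yEdge g d ∎
        where
        a = dipole g d (src d)
        b = dipole g d (tgt d)
        w = len d ⁻¹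
        A = a + a + b
        B = a + b + b
        f : Fin n → Fin (nv Γ) → Carrier
        f i x = drop d (dipole g (edge Γ i)) * dipole g (edge Γ i) x * len (edge Γ i) ⁻¹
        factor : ∀ z x → ∑ n (λ i → w * (z * f i x)) ≈ w * (z * dipole g d x)
        factor z x = trans (∑-*ˡ n w _) (*-congˡ (trans (∑-*ˡ n z _) (*-congˡ (dipole-completeness d x))))

    ∑-squares : ∑ n Q ≈ S
    ∑-squares = begin
      ∑ n Q
        ≈⟨ ∑-weighted-swap (λ i d → drop d (dipole g (edge Γ i)) * drop d (dipole g (edge Γ i))) ⟩
      ∑E Γ (λ d → ∑ n (λ i → drop d (dipole g (edge Γ i)) * drop d (dipole g (edge Γ i)) * len (edge Γ i) ⁻¹))
        ≈⟨ ∑-cong n (λ k → at-edge (edge Γ k)) ⟩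
      S ∎
      where
      at-edge : ∀ d → ∑ n (λ i → drop d (dipole g (edge Γ i)) * drop d (dipole g (edge Γ i)) * len (edge Γ i) ⁻¹)
                ≈ resistance g d
      at-edge d = trans
        (∑-cong n (λ i → solve 4 (λ f s t v → f :* (s :- t) :* v := f :* s :* v :- f :* t :* v) refl
          (drop d (dipole g (edge Γ i))) _ _ _))
        (trans (∑-- n _ _)
          (+-cong (dipole-completeness d (src d)) (-‿cong (dipole-completeness d (tgt d)))))

    ∑-bypass : ∑ n bypass ≈ fromℕ (suc n) - fromℕ (nv Γ)
    ∑-bypass = begin
      ∑ n bypass
        ≈⟨ ∑-- n _ _ ⟩
      ∑ n (λ _ → 1#) - ∑E Γ (λ e → resistance g e * len e ⁻¹)
        ≈⟨ +-cong (∑-one n) (-‿cong foster) ⟩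
      fromℕ n - (fromℕ (nv Γ) - 1#)
        ≈⟨ solve 2 (λ e v → e :- (v :- con (+ 1)) := (con (+ 1) :+ e) :- v) refl _ _ ⟩
      fromℕ (suc n) - fromℕ (nv Γ) ∎

    -- `genus` uses truncated subtraction, so this bound is needed to read it in the field. It
    -- follows from Foster's identity: the total of the fractions `bypass` is nonnegative.
    nv≤suc-nE : nv Γ ℕ.≤ suc n
    nv≤suc-nE = ℕ.≮⇒≥ λ lt → pos⇒≉0
      (+-pos-nonNeg
        (<.<-respˡ-≈ (-‿inverseʳ _) (+-monoˡ-< (- fromℕ (suc n)) (fromℕ-mono-< lt)))
        (nonNeg-resp ∑-bypass (∑-nonNeg n At.bypass-nonNeg)))
      (solve 2 (λ x y → (x :- y) :+ (y :- x) := con (+ 0)) refl (fromℕ (nv Γ)) (fromℕ (suc n)))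

    ∑-bypass-genus : ∑ n bypass ≈ fromℕ (genus Γ)
    ∑-bypass-genus = trans ∑-bypass (sym (fromℕ-∸ (suc n) (nv Γ) nv≤suc-nE))

    private
      ratio : Fin n → Carrier
      ratio i = len (edge Γ i) ÷ (len (edge Γ i) + Rk Γ i (V i))
      γ = fromℕ (genus Γ)

    ∑-linear : ∀ C (h k : Fin n → Carrier) →
      ∑ n (λ i → bypass i * C + h i - k i) ≈ γ * C + ∑ n h - ∑ n k
    ∑-linear C h k = trans (∑-- n _ _) (+-congʳ (trans (∑-+ n _ _)
      (+-congʳ (trans (∑-*ʳ n C bypass) (*-congʳ ∑-bypass-genus)))))

    -- The origin of the factor g + 1: the cross terms contribute `Y` twice and the deleted summands
    -- remove it once. For resistances the corresponding contribution is a single `S`, which cancels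
    -- and leaves g.
    ∑-y : ∑ n (λ i → bypass i * ∑E (Γ ─ i) (yEdge (At.g′ i))) ≈ γ * Y + Y
    ∑-y = begin
      ∑ n (λ i → bypass i * ∑E (Γ ─ i) (yEdge (At.g′ i)))
        ≈⟨ ∑-cong n At.bypass-y ⟩
      ∑ n (λ i → bypass i * Y + X i - yEdge g (edge Γ i))
        ≈⟨ ∑-linear Y X _ ⟩
      γ * Y + ∑ n X - Y
        ≈⟨ +-congʳ (+-congˡ ∑-cross) ⟩
      γ * Y + (Y + Y) - Y
        ≈⟨ solve 2 (λ g y → g :* y :+ (y :+ y) :- y := g :* y :+ y) refl γ Y ⟩
      γ * Y + Y ∎

    ∑-resistance : ∑ n (λ i → bypass i * ∑E (Γ ─ i) (resistance (At.g′ i))) ≈ γ * S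
    ∑-resistance = begin
      ∑ n (λ i → bypass i * ∑E (Γ ─ i) (resistance (At.g′ i)))
        ≈⟨ ∑-cong n At.bypass-resistance ⟩
      ∑ n (λ i → bypass i * S + Q i - resistance g (edge Γ i))
        ≈⟨ ∑-linear S Q _ ⟩
      γ * S + ∑ n Q - S
        ≈⟨ +-congʳ (+-congˡ ∑-squares) ⟩
      γ * S + S - S
        ≈⟨ solve 2 (λ g s → g :* s :+ s :- s := g :* s) refl γ S ⟩
      γ * S ∎

    private
      module Γ-terms = Terms Γ L>0 connected isGreen

    -- x is `S - Y`; the surplus `Y` in the sum of the deleted y values is what appears as y(Γ) on
    -- the right.
    x-recursion : γ * xval Γ p (λ i → inj₂ (V i)) ≈
      yval Γ p (λ i → inj₂ (V i)) + ∑ n (λ i → ratio i * xval (Γ ─ i) p (D i))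
    x-recursion = begin
      γ * xval Γ p (λ i → inj₂ (V i))
        ≈⟨ *-congˡ (Γ-terms.xval-≈ (λ i → inj₂ (V i))) ⟩
      γ * (S - Y)
        ≈⟨ solve 3 (λ g s y → g :* (s :- y) := y :+ (g :* s :- (g :* y :+ y))) refl γ S Y ⟩
      Y + (γ * S - (γ * Y + Y))
        ≈⟨ +-cong (Γ-terms.yval-≈ (λ i → inj₂ (V i))) (begin
             ∑ n (λ i → ratio i * xval (Γ ─ i) p (D i))
               ≈⟨ ∑-cong n (λ i → *-cong (At.L÷M i) (At.xval-≈ i (D i))) ⟩
             ∑ n (λ i → bypass i * (S′ i - Y′ i))
               ≈⟨ ∑-cong n (λ i → solve 3 (λ b s y → b :* (s :- y) := b :* s :- b :* y) refl _ _ _) ⟩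
             ∑ n (λ i → bypass i * S′ i - bypass i * Y′ i)
               ≈⟨ ∑-- n _ _ ⟩
             ∑ n (λ i → bypass i * S′ i) - ∑ n (λ i → bypass i * Y′ i)
               ≈⟨ +-cong ∑-resistance (-‿cong ∑-y) ⟩
             γ * S - (γ * Y + Y) ∎) ⟨
      yval Γ p (λ i → inj₂ (V i)) + ∑ n (λ i → ratio i * xval (Γ ─ i) p (D i)) ∎
      where
      S′ Y′ : Fin n → Carrier
      S′ i = ∑E (Γ ─ i) (resistance (At.g′ i))
      Y′ i = ∑E (Γ ─ i) (yEdge (At.g′ i))

    y-recursion : fromℕ (suc (genus Γ)) * yval Γ p (λ i → inj₂ (V i)) ≈
      ∑ n (λ i → ratio i * yval (Γ ─ i) p (D i))
    y-recursion = begin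
      (1# + γ) * yval Γ p (λ i → inj₂ (V i))
        ≈⟨ *-congˡ (Γ-terms.yval-≈ (λ i → inj₂ (V i))) ⟩
      (1# + γ) * Y
        ≈⟨ solve 2 (λ g y → (con (+ 1) :+ g) :* y := g :* y :+ y) refl γ Y ⟩
      γ * Y + Y
        ≈⟨ ∑-y ⟨
      ∑ n (λ i → bypass i * ∑E (Γ ─ i) (yEdge (At.g′ i)))
        ≈⟨ ∑-cong n (λ i → *-cong (At.L÷M i) (At.yval-≈ i (D i))) ⟨
      ∑ n (λ i → ratio i * yval (Γ ─ i) p (D i)) ∎

theorem4p17 : {c ℓ₁ ℓ₂ : Level} (F : OrderedField c ℓ₁ ℓ₂) →
    let open OrderedField F
        open CommutativeRing commutativeRing
        open Network F
    in (Γ : MGraph) → PositiveLengths Γ → Connected Γ → Bridgeless Γ →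
       (p : Fin (nv Γ)) →
       (VΓ : (i : Fin (nE Γ)) → VoltageFn (Γ ─ i)) →
       (D : (i : Fin (nE Γ)) → ElecData (Γ ─ i)) →
       (fromℕ (genus Γ) * xval Γ p (λ i → inj₂ (VΓ i))
          ≈ yval Γ p (λ i → inj₂ (VΓ i))
            + ∑ (nE Γ) (λ i → (Edge.len (edge Γ i) ÷ (Edge.len (edge Γ i) + Rk Γ i (VΓ i)))
                               * xval (Γ ─ i) p (D i)))
       × (fromℕ (suc (genus Γ)) * yval Γ p (λ i → inj₂ (VΓ i))
          ≈ ∑ (nE Γ) (λ i → (Edge.len (edge Γ i) ÷ (Edge.len (edge Γ i) + Rk Γ i (VΓ i)))
                               * yval (Γ ─ i) p (D i)))
-- Without edges there is no deleted graph from which to obtain a Green function, but all sums are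
-- empty.
theorem4p17 F Γ@record { edges = [] } L>0 connected bridgeless p V D =
  trans (zeroʳ _) (sym (+-identityˡ 0#)) , zeroʳ _
  where open CommutativeRing (OrderedField.commutativeRing F)
theorem4p17 F Γ@record { edges = _ ∷ _ } L>0 connected bridgeless p V D = x-recursion , y-recursion
  where
  open Electrical F
  -- The choice of the restored edge is arbitrary; a nonempty list offers its first.
  green = green-from-─ Γ L>0 Fin.zero (V Fin.zero) p
  open Recursion Γ L>0 connected bridgeless {g = proj₁ green} (proj₂ green) V D
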